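{- For every integer $N\geq 2$, $$\varepsilon_0(N,2)=2\sum_{i=0}^{N-2}\varepsilon_0(i)\,\varepsilon_0(N-i-1,2)+N(2N-1)\,\varepsilon_0(N-1).$$
   Context: Gluings and their counts. Let $N\ge 1$, $K\ge1$. A gluing datum with $N$ edges and $K$ faces consists of a composition $(m_1,\dots,m_K)$ of $2N$ into positive integers together with a fixed-point-free involution $\iota$ of $\{1,\dots,2N\}$. Put $s_0=0$, $s_i=m_1+\dots+m_i$, and let $\tau$ be the permutation of $\{1,\dots,2N\}$ whose cycles are $(s_{i-1}+1,\,s_{i-1}+2,\,\dots,\,s_i)$, $i=1,\dots,K$. The datum is connected if the group $\langle\iota,\tau\rangle$ acts transitively on $\{1,\dots,2N\}$, and it has genus $g$ if the permutation $\tau\iota$ has exactly $N-K+2-2g$ cycles. (Geometrically: this is the gluing of $K$ numbered polygons with $m_1,\dots,m_K$ edges, each with a distinguished edge, where the edges are paired by $\iota$ and paired edges are glued with opposite orientations, producing a connected closed orientable surface of genus $g$; equivalently a rooted map on that surface with $N$ edges and $K$ numbered faces, each face having one marked arc, counted up to isomorphism.) $\varepsilon_g(N,K)$ denotes the number of connected gluing data of genus $g$ with $N$ edges and $K$ faces. For $N=0$ one sets $\varepsilon_0(0,1)=1$ and $\varepsilon_g(0,K)=0$ if $g+K>1$. Also $\varepsilon_g(N):=\varepsilon_g(N,1)$ (gluings from a single polygon). -}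

module Defs where

open import Data.Nat using (ℕ; zero; suc; _+_; _*_; _∸_; _≤_; _<_; _<?_; _≤?_)
import Data.Nat as ℕ
open import Data.Fin using (Fin; toℕ; fromℕ<)
import Data.Fin as F
open import Data.Fin.Properties using (all?)
open import Data.Vec using (Vec; []; _∷_; lookup)
open import Data.List using (List; []; _∷_; _++_; map; concatMap; upTo; allFin; length; filter; cartesianProduct; sum)
open import Data.List.Relation.Unary.Any using (Any; any?)
open import Data.Product using (_×_; _,_; proj₁; proj₂)
open import Relation.Binary.PropositionalEquality using (_≡_)
open import Relation.Nullary using (¬_; Dec; yes; no)
open import Relation.Nullary.Decidable using (_×-dec_; ¬?)
open import Relation.Unary using (Decidable)
open import Data.Bool using (if_then_else_)
open import Relation.Nullary.Decidable using (⌊_⌋)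

compositions : ℕ → ℕ → List (List ℕ)
compositions zero    zero    = [] ∷ []
compositions (suc _) zero    = []
compositions n       (suc K) =
  concatMap (λ m → map (suc m ∷_) (compositions (n ∸ suc m) K)) (upTo n)

allVecs : (k n : ℕ) → List (Vec (Fin n) k)
allVecs zero    n = [] ∷ []
allVecs (suc k) n = concatMap (λ v → map (_∷ v) (allFin n)) (allVecs k n)

IsFFInvolution : {n : ℕ} → Vec (Fin n) n → Set
IsFFInvolution {n} v = ∀ (i : Fin n) → (lookup v (lookup v i) ≡ i) × ¬ (lookup v i ≡ i)

isFFInvolution? : {n : ℕ} → Decidable (IsFFInvolution {n})
isFFInvolution? v = all? (λ i → (lookup v (lookup v i) F.≟ i) ×-dec ¬? (lookup v i F.≟ i))

ffInvolutions : (n : ℕ) → List (Vec (Fin n) n)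
ffInvolutions n = filter isFFInvolution? (allVecs n n)

-- The permutation τ on ℕ (0-indexed) for a composition: cycles
-- (s_{i-1}, s_{i-1}+1, …, s_i - 1); the second argument is the current offset s.
tauℕ : List ℕ → ℕ → ℕ → ℕ
tauℕ []       s x = x
tauℕ (m ∷ ms) s x =
  if ⌊ x <? s + m ⌋ then (if ⌊ suc x <? s + m ⌋ then suc x else s)
  else tauℕ ms (s + m) x

-- Convert a natural number to Fin n, falling back to a default if out of range
-- (never happens for compositions of n).
toFinOr : {n : ℕ} → ℕ → Fin n → Fin n
toFinOr {n} y d with y <? n
... | yes p = fromℕ< p
... | no  _ = d

tau : {n : ℕ} → List ℕ → Fin n → Fin n
tau cs x = toFinOr (tauℕ cs 0 (toℕ x)) x

iter : {A : Set} → ℕ → (A → A) → A → A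
iter zero    f x = x
iter (suc k) f x = f (iter k f x)

-- x is the least element of its cycle under σ (a permutation of Fin n);
-- every cycle has length ≤ n, so iterates σ^k, k < n, exhaust the cycle.
IsCycleMin : {n : ℕ} → (Fin n → Fin n) → Fin n → Set
IsCycleMin {n} σ x = ∀ (k : Fin n) → toℕ x ≤ toℕ (iter (toℕ k) σ x)

isCycleMin? : {n : ℕ} (σ : Fin n → Fin n) → Decidable (IsCycleMin σ)
isCycleMin? σ x = all? (λ k → toℕ x ≤? toℕ (iter (toℕ k) σ x))

numCycles : {n : ℕ} → (Fin n → Fin n) → ℕ
numCycles {n} σ = length (filter (isCycleMin? σ) (allFin n))

reach : {n : ℕ} → (Fin n → Fin n) → (Fin n → Fin n) → ℕ → Fin n → List (Fin n)
reach ι τ zero    x = x ∷ []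
reach ι τ (suc k) x = let R = reach ι τ k x in R ++ map ι R ++ map τ R

-- ⟨ι,τ⟩ acts transitively on Fin n. (For permutations of a finite set the
-- group generated equals the monoid generated, and the Schreier graph has
-- diameter < n, so words of length ≤ n suffice.)
Transitive : {n : ℕ} → (Fin n → Fin n) → (Fin n → Fin n) → Set
Transitive {n} ι τ = ∀ (x y : Fin n) → Any (y ≡_) (reach ι τ n x)

transitive? : {n : ℕ} (ι τ : Fin n → Fin n) → Dec (Transitive ι τ)
transitive? {n} ι τ = all? (λ x → all? (λ y → any? (y F.≟_) (reach ι τ n x)))

-- A gluing datum with N edges and K faces.
Datum : ℕ → Set
Datum N = List ℕ × Vec (Fin (2 * N)) (2 * N)

-- connected and of genus g:  #cycles(τι) = N - K + 2 - 2g  (written additively)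
GoodDatum : (g N K : ℕ) → Datum N → Set
GoodDatum g N K (cs , v) =
  Transitive (lookup v) (tau cs)
  × (numCycles (λ x → tau cs (lookup v x)) + K + 2 * g ≡ N + 2)

goodDatum? : (g N K : ℕ) → Decidable (GoodDatum g N K)
goodDatum? g N K (cs , v) =
  transitive? (lookup v) (tau cs)
  ×-dec (numCycles (λ x → tau cs (lookup v x)) + K + 2 * g ℕ.≟ N + 2)

ε : (g N K : ℕ) → ℕ
ε zero    zero 1 = 1
ε g       zero K = 0
ε g N@(suc _) K =
  length (filter (goodDatum? g N K)
    (cartesianProduct (compositions (2 * N) K) (ffInvolutions (2 * N))))

ε₁ : (g N : ℕ) → ℕ
ε₁ g N = ε g N 1

{-# OPTIONS --safe #-}

-- Fix σ = τι, whose cycles are the vertices, and delete the edge {x, y}, y = ι x, by passing to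
-- τ ∘ (x y) and to the involution in which x and y have become fixed points ("dead" letters).  The
-- product of the two is still σ, while the polygon through x is split in two if it contains y and
-- is merged with the polygon through y otherwise.  Once no edge is left, τ = σ, so the number of
-- vertices is the final number of polygons.  Hence K polygons with N edges have at most K + N
-- vertices, with equality iff every step is a split, that is, iff each polygon is glued up by a
-- noncrossing pairing of its own (NC).  If some edge joins two given polygons, then K + N - 2
-- vertices mean that exactly one step is a merge.  In such an annular pairing (Ann) the edge at the
-- first letter of the first polygon either crosses to the second polygon, leaving a noncrossing
-- pairing of the merged polygon, or cuts the first polygon into a noncrossing and an annular part.
-- Both kinds are counted by the lengths of the polygons alone, and summing the resulting recursion
-- over all pairs of lengths with sum 2N gives the theorem.
module Submission where

open import Defs
open import Data.Nat using (ℕ; _+_; _*_; _∸_; _≤_)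
open import Data.List using (map; upTo)
open import Data.Nat.ListAction using (sum)
open import Relation.Binary.PropositionalEquality using (_≡_)

open import Data.Bool using (if_then_else_)
open import Data.Empty using (⊥; ⊥-elim)
open import Data.Fin using (Fin; zero; suc; _≟_; toℕ; fromℕ; fromℕ<; inject₁; _↑ˡ_; _↑ʳ_)
open import Data.Fin.Properties using (toℕ<n; toℕ-inject₁; toℕ-fromℕ; toℕ-↑ˡ; toℕ-↑ʳ; toℕ-injective; toℕ-fromℕ<)
open import Data.List using (List; []; _∷_; _++_; length; filter; concat; concatMap; allFin; tabulate; take; drop; applyUpTo; cartesianProduct)
open import Data.List.Membership.Propositional using (_∈_; _∉_; find; lose)
open import Data.List.Membership.Propositional.Properties
import Data.List.Membership.DecPropositional as DecMembership
open import Data.List.Properties using (++-assoc; ++-identityʳ; ∷-injective; ∷-injectiveˡ; ∷-injectiveʳ; filter-++; filter-accept; filter-all; filter-none; filter-reject; length-++; length-++-≤ˡ; length-++-≤ʳ; length-drop; length-map; length-tabulate; length-take; map-upTo; take++drop≡id)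
open import Data.List.Relation.Binary.Permutation.Propositional using (_↭_; prep; swap; ↭-refl; ↭-reflexive; ↭-sym; ↭-trans; ↭⇒↭ₛ)
import Data.List.Relation.Binary.Permutation.Propositional as ↭
open import Data.List.Relation.Binary.Permutation.Propositional.Properties using (shift; shifts; ++-comm; ++⁺ˡ; ++⁺ʳ; ∈-resp-↭; All-resp-↭; filter-↭; ↭-length)
import Data.List.Relation.Binary.Permutation.Setoid.Properties as ↭ₛ
open import Data.List.Relation.Unary.All as All using (All; []; _∷_)
open import Data.List.Relation.Unary.AllPairs using ([]; _∷_)
open import Data.List.Relation.Unary.Any using (here; there; any?)
open import Data.List.Relation.Unary.Unique.Propositional using (Unique)
import Data.List.Relation.Unary.Unique.Propositional.Properties as Unique
open import Data.Nat using (zero; suc; _⊓_; _<_; _<?_; _≤′_; ≤′-refl; ≤′-step; z≤n; s≤s)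
open import Data.Nat.Properties hiding (_≟_; _<?_)
open import Data.Nat.Tactic.RingSolver using (solve-∀)
open import Data.Product using (_×_; _,_; proj₁; proj₂; ∃; ∃₂)
open import Data.Sum using (_⊎_; inj₁; inj₂)
open import Data.Unit using (⊤; tt)
open import Data.Vec as Vec using (Vec; []; _∷_; lookup; _[_]≔_)
import Data.Vec.Properties as Vec
open import Function using (_∘_; case_of_; flip)
open import Relation.Binary.PropositionalEquality using (_≢_; refl; cong; cong₂; sym; trans; subst; subst₂; setoid; module ≡-Reasoning)
open import Relation.Nullary using (¬_; does; yes; no)
open import Relation.Nullary.Decidable using (¬?)
open import Relation.Unary using (Decidable)

-- By the genus formula a planar datum has `N + 2 - K` vertices: `N + 1` for one polygon, which is
-- the maximum `K + N`, and `N` for two, which is `K + N - 2`. Planarity thus becomes a statement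
-- about a number that no deletion of an edge changes. A deletion may, however, disconnect the
-- surface and multiply the polygons. The induction therefore runs over arbitrary lists of polygons
-- and does not mention connectedness; for two polygons its place is taken by a letter `z` whose
-- edge leads from the first to the second. Dead letters stay on the polygons and are merely skipped
-- by `live`. So `σ` remains literally the same function on `Fin n`, and its cycles are counted only
-- once, when no edge is left. The noncrossing part may lie on either side of the arc at the first
-- letter, whence the factor 2 of the theorem. The coefficient `N * (2 * N ∸ 1)` counts the possible
-- ends of a crossing edge: the letters of the second polygon, over all pairs of lengths.

private variable
  A B : Set
  n : ℕ

-- Lists without repetitions and finite cardinalities

unique-resp-↭ : {xs ys : List A} → xs ↭ ys → Unique xs → Unique ys
unique-resp-↭ = ↭ₛ.Unique-resp-↭ (setoid _) ∘ ↭⇒↭ₛ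

unique-++⁻ : (xs : List A) {ys : List A} → Unique (xs ++ ys) →
  Unique xs × Unique ys × (∀ {z} → z ∈ xs → z ∉ ys)
unique-++⁻ []       u       = [] , u , λ ()
unique-++⁻ (x ∷ xs) (p ∷ u) with unique-++⁻ xs u
... | u₁ , u₂ , disjoint =
  All.tabulate (λ z∈ → All.lookup p (∈-++⁺ˡ z∈)) ∷ u₁ , u₂ , λ where
    (here refl) z∈ → All.lookup p (∈-++⁺ʳ xs z∈) refl
    (there z∈)     → disjoint z∈

∷-unique : {x : A} {xs : List A} → x ∉ xs → Unique xs → Unique (x ∷ xs)
∷-unique x∉ u = All.tabulate (λ { z∈ refl → x∉ z∈ }) ∷ u

head∉ : {x : A} {xs : List A} → Unique (x ∷ xs) → x ∉ xs
head∉ (p ∷ _) x∈ = All.lookup p x∈ refl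

-- The list is built along the recursive structure of `S`; through `card-unique`, counting one set
-- in two ways then yields an equation between numbers.
record Card {A : Set} (S : A → Set) (k : ℕ) : Set where
  field
    elems    : List A
    unique   : Unique elems
    sound    : ∀ {a} → a ∈ elems → S a
    complete : ∀ {a} → S a → a ∈ elems
    size     : length elems ≡ k
open Card

⊆-length : {xs ys : List A} → Unique xs → (∀ {z} → z ∈ xs → z ∈ ys) → length xs ≤ length ys
⊆-length {xs = []}     u       s = z≤n
⊆-length {xs = x ∷ xs} (p ∷ u) s with ∈-∃++ (s (here refl))
... | as , bs , refl =
  ≤-trans (s≤s (⊆-length u s′)) (≤-reflexive (sym (↭-length (shift x as bs))))
  where
  s′ : ∀ {z} → z ∈ xs → z ∈ as ++ bs
  s′ z∈ with ∈-resp-↭ (shift x as bs) (s (there z∈))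
  ... | here refl = ⊥-elim (All.lookup p z∈ refl)
  ... | there q   = q

card-unique : {S : A → Set} {j k : ℕ} → Card S j → Card S k → j ≡ k
card-unique c d = trans (sym (size c)) (trans
  (≤-antisym (⊆-length (unique c) (complete d ∘ sound c)) (⊆-length (unique d) (complete c ∘ sound d)))
  (size d))

-- Injectivity is relative to `S` because `glue` is injective only on pairs of vectors that fix all
-- letters outside their own parts.
card-map : {S : A → Set} {T : B → Set} {k : ℕ} (f : A → B) →
  (∀ {a a′} → S a → S a′ → f a ≡ f a′ → a ≡ a′) →
  (∀ {a} → S a → T (f a)) → (∀ {b} → T b → ∃ λ a → S a × b ≡ f a) →
  Card S k → Card T k
card-map {S = S} {T} f inj to from c = record
  { elems    = map f (elems c)
  ; unique   = map-unique (elems c) (sound c) (unique c)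
  ; sound    = λ b∈ → let a , a∈ , eq = ∈-map⁻ f b∈ in subst T (sym eq) (to (sound c a∈))
  ; complete = λ t → let a , s , eq = from t in subst (_∈ _) (sym eq) (∈-map⁺ f (complete c s))
  ; size     = trans (length-map f (elems c)) (size c)
  }
  where
  map-unique : ∀ as → (∀ {a} → a ∈ as → S a) → Unique as → Unique (map f as)
  map-unique []       s u       = []
  map-unique (a ∷ as) s (p ∷ u) = ∷-unique
    (λ fa∈ → let a′ , a′∈ , eq = ∈-map⁻ f fa∈ in
             All.lookup p a′∈ (inj (s (here refl)) (s (there a′∈)) eq))
    (map-unique as (s ∘ there) u)

card-⇔ : {S T : A → Set} {k : ℕ} → (∀ {a} → S a → T a) → (∀ {a} → T a → S a) → Card S k → Card T k
card-⇔ to from = card-map (λ a → a) (λ _ _ eq → eq) to (λ t → _ , from t , refl)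

card-⊥ : {S : A → Set} → (∀ {a} → S a → ⊥) → Card S 0
card-⊥ ¬S = record { elems = [] ; unique = [] ; sound = λ () ; complete = λ s → ⊥-elim (¬S s) ; size = refl }

card-singleton : (a : A) → Card (a ≡_) 1
card-singleton a = record
  { elems = a ∷ [] ; unique = [] ∷ [] ; sound = λ { (here refl) → refl }
  ; complete = λ { refl → here refl } ; size = refl }

card-⊎ : {S T : A → Set} {j k : ℕ} → (∀ {a} → S a → T a → ⊥) →
  Card S j → Card T k → Card (λ a → S a ⊎ T a) (j + k)
card-⊎ disjoint c d = record
  { elems    = elems c ++ elems d
  ; unique   = Unique.++⁺ (unique c) (unique d) (λ { (p , q) → disjoint (sound c p) (sound d q) })
  ; sound    = λ a∈ → case a∈
  ; complete = λ { (inj₁ s) → ∈-++⁺ˡ (complete c s) ; (inj₂ t) → ∈-++⁺ʳ (elems c) (complete d t) }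
  ; size     = trans (length-++ (elems c)) (cong₂ _+_ (size c) (size d))
  }
  where
  case : ∀ {a} → a ∈ elems c ++ elems d → _
  case a∈ with ∈-++⁻ (elems c) a∈
  ... | inj₁ p = inj₁ (sound c p)
  ... | inj₂ p = inj₂ (sound d p)

card-× : {S : A → Set} {T : B → Set} {j k : ℕ} →
  Card S j → Card T k → Card (λ (a , b) → S a × T b) (j * k)
card-× c d = record
  { elems    = cartesianProduct (elems c) (elems d)
  ; unique   = Unique.cartesianProduct⁺ (unique c) (unique d)
  ; sound    = λ p → let a∈ , b∈ = ∈-cartesianProduct⁻ (elems c) (elems d) p in sound c a∈ , sound d b∈
  ; complete = λ (s , t) → ∈-cartesianProduct⁺ (complete c s) (complete d t)
  ; size     = trans (length-cartesianProduct (elems c) (elems d)) (cong₂ _*_ (size c) (size d))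
  }
  where
  length-cartesianProduct : ∀ as bs → length (cartesianProduct as bs) ≡ length as * length bs
  length-cartesianProduct []       bs = refl
  length-cartesianProduct (a ∷ as) bs = trans (length-++ (map (a ,_) bs))
    (cong₂ _+_ (length-map (a ,_) bs) (length-cartesianProduct as bs))

card-filter : {S P : A → Set} (P? : Decidable P) (xs : List A) → Unique xs →
  (∀ {a} → a ∈ xs → P a → S a) → (∀ {a} → S a → a ∈ xs × P a) →
  Card S (length (filter P? xs))
card-filter P? xs u to from = record
  { elems    = filter P? xs
  ; unique   = Unique.filter⁺ P? u
  ; sound    = λ p → let a∈ , pa = ∈-filter⁻ P? p in to a∈ pa
  ; complete = λ s → let a∈ , pa = from s in ∈-filter⁺ P? a∈ pa
  ; size     = refl
  }

-- conv k p = Σ_{a+1+b=p} k a b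
conv : (ℕ → ℕ → ℕ) → ℕ → ℕ
conv k zero    = 0
conv k (suc p) = k 0 p + conv (λ a → k (suc a)) p

-- In the applications `y` is the partner of the first letter of a polygon. The count may depend on
-- its position only through the numbers of letters before and behind it, which turns the sum over
-- letters into a `conv`.
card-splits : {S : A → B → Set} (k : ℕ → ℕ → ℕ) (ys : List A) → Unique ys →
  (∀ {y y′ b} → S y b → S y′ b → y ≡ y′) →
  (∀ as y bs → as ++ y ∷ bs ≡ ys → Card (S y) (k (length as) (length bs))) →
  Card (λ b → ∃ λ y → y ∈ ys × S y b) (conv k (length ys))
card-splits k []       u       disjoint c = card-⊥ λ { (_ , () , _) }
card-splits {S = S} k (y ∷ ys) (p ∷ u) disjoint c = card-⇔
  (λ { (inj₁ s) → y , here refl , s ; (inj₂ (y′ , y′∈ , s)) → y′ , there y′∈ , s })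
  (λ { (y′ , here refl , s) → inj₁ s ; (y′ , there y′∈ , s) → inj₂ (y′ , y′∈ , s) })
  (card-⊎ (λ { s (y′ , y′∈ , s′) → All.lookup p y′∈ (disjoint s s′) })
    (c [] y ys refl)
    (card-splits (λ a → k (suc a)) ys u disjoint (λ as y′ bs eq → c (y ∷ as) y′ bs (cong (y ∷_) eq))))

-- Noncrossing and annular pairings

infixl 9 _!_
_!_ : Vec A n → Fin n → A
_!_ = lookup

vec-ext : {v w : Vec A n} → (∀ z → v ! z ≡ w ! z) → v ≡ w
vec-ext {v = v} {w} eq = trans (sym (Vec.tabulate∘lookup v)) (trans (Vec.tabulate-cong eq) (Vec.tabulate∘lookup w))

-- The letter `y` occurs only once and so determines where the list is cut. This is what makes the
-- decompositions in `NC` and `Ann` unambiguous.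
split-unique : {y : A} (as {bs} cs {ds} : List A) → Unique (as ++ y ∷ bs) →
  as ++ y ∷ bs ≡ cs ++ y ∷ ds → as ≡ cs × bs ≡ ds
split-unique []       []       u refl = refl , refl
split-unique []       (c ∷ cs) u refl = ⊥-elim (head∉ u (∈-++⁺ʳ cs (here refl)))
split-unique (a ∷ as) []       u refl = ⊥-elim (head∉ u (∈-++⁺ʳ as (here refl)))
split-unique (a ∷ as) (c ∷ cs) (_ ∷ u) eq with ∷-injective eq
... | refl , eq′ with split-unique as cs u eq′
... | refl , refl = refl , refl

module _ {n : ℕ} (v : Vec (Fin n) n) where

  -- The arc at the first letter encloses `as` and leaves `bs` behind it: the Catalan decomposition.
  -- On a list without repetitions the partner of the first letter determines both parts.
  data NC : List (Fin n) → Set where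
    []  : NC []
    arc : ∀ {x y as bs} → v ! x ≡ y → v ! y ≡ x → NC as → NC bs → NC (x ∷ as ++ y ∷ bs)

  -- Cutting the annulus along a crossing edge gives a disc; the second polygon is then read from
  -- the letter after `y`, hence `bs ++ cs` in `bridge`. An arc that returns to the first polygon
  -- separates the annulus, so that only one of its sides can still reach the second polygon: `bs`
  -- in `left`, `as` in `right`.
  data Ann : List (Fin n) → List (Fin n) → Set where
    bridge : ∀ {x y as bs cs} → v ! x ≡ y → v ! y ≡ x → NC (as ++ bs ++ cs) → Ann (x ∷ as) (cs ++ y ∷ bs)
    left   : ∀ {x y as bs qs} → v ! x ≡ y → v ! y ≡ x → NC as → Ann bs qs → Ann (x ∷ as ++ y ∷ bs) qs
    right  : ∀ {x y as bs qs} → v ! x ≡ y → v ! y ≡ x → Ann as qs → NC bs → Ann (x ∷ as ++ y ∷ bs) qs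

-- A pairing of the letters in ps is coded as a vector on all n letters that fixes the others, so that
-- pairings of different polygons can be composed without relabelling.
FixedOff : Vec (Fin n) n → List (Fin n) → Set
FixedOff v ps = ∀ z → z ∉ ps → v ! z ≡ z

FixedOff-↭ : (v : Vec (Fin n) n) {ps qs : List (Fin n)} → ps ↭ qs → FixedOff v ps → FixedOff v qs
FixedOff-↭ v p fix z z∉ = fix z (z∉ ∘ ∈-resp-↭ p)

∈-arc⁻ : ∀ {x y z : A} as {bs} → z ∈ x ∷ as ++ y ∷ bs → z ≡ x ⊎ z ≡ y ⊎ z ∈ as ⊎ z ∈ bs
∈-arc⁻ as (here eq) = inj₁ eq
∈-arc⁻ as (there z∈) with ∈-++⁻ as z∈
... | inj₁ z∈as         = inj₂ (inj₂ (inj₁ z∈as))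
... | inj₂ (here eq)    = inj₂ (inj₁ eq)
... | inj₂ (there z∈bs) = inj₂ (inj₂ (inj₂ z∈bs))

∈-arcˡ : ∀ {x y z : A} {as bs} → z ∈ as → z ∈ x ∷ as ++ y ∷ bs
∈-arcˡ = there ∘ ∈-++⁺ˡ

∈-arcʳ : ∀ {x y z : A} as {bs} → z ∈ bs → z ∈ x ∷ as ++ y ∷ bs
∈-arcʳ as = there ∘ ∈-++⁺ʳ as ∘ there

module _ {v : Vec (Fin n) n} where

  NC-closed : ∀ {ps z} → NC v ps → z ∈ ps → v ! z ∈ ps
  NC-closed (arc {as = as} xy yx p q) z∈ with ∈-arc⁻ as z∈
  ... | inj₁ refl               = there (∈-++⁺ʳ as (here xy))
  ... | inj₂ (inj₁ refl)        = here yx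
  ... | inj₂ (inj₂ (inj₁ z∈as)) = ∈-arcˡ (NC-closed p z∈as)
  ... | inj₂ (inj₂ (inj₂ z∈bs)) = ∈-arcʳ as (NC-closed q z∈bs)

  NC-cong : ∀ {w ps} → (∀ {z} → z ∈ ps → v ! z ≡ w ! z) → NC v ps → NC w ps
  NC-cong eq []                         = []
  NC-cong eq (arc {as = as} xy yx p q) = arc
    (trans (sym (eq (here refl))) xy)
    (trans (sym (eq (there (∈-++⁺ʳ as (here refl))))) yx)
    (NC-cong (eq ∘ ∈-arcˡ) p) (NC-cong (eq ∘ ∈-arcʳ as) q)

  NC-arc⁻ : ∀ {x y as bs} → Unique (as ++ y ∷ bs) → v ! x ≡ y → NC v (x ∷ as ++ y ∷ bs) →
    v ! y ≡ x × NC v as × NC v bs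
  -- An index containing `_++_` does not unify with that of `arc`, so the tail is generalised to
  -- `ps` and linked by an equation, which `split-unique` then resolves.
  NC-arc⁻ {x} {y} {as} {bs} u xy p = go p refl
    where
    go : ∀ {ps} → NC v (x ∷ ps) → as ++ y ∷ bs ≡ ps → v ! y ≡ x × NC v as × NC v bs
    go (arc {as = cs} xy′ yx p q) eq with trans (sym xy) xy′
    ... | refl with split-unique as cs u eq
    ... | refl , refl = yx , p , q

  -- This is the connectedness of an annular pairing. It yields transitivity, and it separates
  -- `left` from `right`, since a noncrossing side is closed under `v`.
  Ann-crosses : ∀ {ps qs} → Ann v ps qs → ∃ λ z → z ∈ ps × v ! z ∈ qs
  Ann-crosses (bridge {x} {cs = cs} xy yx p) = x , here refl , ∈-++⁺ʳ cs (here xy)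
  Ann-crosses (left {as = as} xy yx p q)     = let z , z∈ , vz∈ = Ann-crosses q in z , ∈-arcʳ as z∈ , vz∈
  Ann-crosses (right xy yx p q)              = let z , z∈ , vz∈ = Ann-crosses p in z , ∈-arcˡ z∈ , vz∈

∈-merge⁻ : ∀ {x y z : A} as bs cs → z ∈ (x ∷ as) ++ cs ++ y ∷ bs →
  z ≡ x ⊎ z ≡ y ⊎ z ∈ as ++ bs ++ cs
∈-merge⁻ as bs cs (here eq) = inj₁ eq
∈-merge⁻ as bs cs (there z∈) with ∈-++⁻ as z∈
... | inj₁ q = inj₂ (inj₂ (∈-++⁺ˡ q))
... | inj₂ q with ∈-++⁻ cs q
... | inj₁ r         = inj₂ (inj₂ (∈-++⁺ʳ as (∈-++⁺ʳ bs r)))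
... | inj₂ (here eq) = inj₂ (inj₁ eq)
... | inj₂ (there r) = inj₂ (inj₂ (∈-++⁺ʳ as (∈-++⁺ˡ r)))

module _ {x y : A} where

  ↭-arc : ∀ as bs → x ∷ y ∷ as ++ bs ↭ x ∷ as ++ y ∷ bs
  ↭-arc as bs = prep x (↭-sym (shift y as bs))

  ↭-left : ∀ as bs qs → x ∷ y ∷ as ++ bs ++ qs ↭ (x ∷ as ++ y ∷ bs) ++ qs
  ↭-left as bs qs = ↭-trans (↭-reflexive (cong (λ r → x ∷ y ∷ r) (sym (++-assoc as bs qs))))
    (++⁺ʳ qs (↭-arc as bs))

  ↭-right : ∀ as bs qs → x ∷ y ∷ (as ++ qs) ++ bs ↭ (x ∷ as ++ y ∷ bs) ++ qs
  ↭-right as bs qs = ↭-trans (prep x (prep y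
    (↭-trans (↭-reflexive (++-assoc as qs bs)) (++⁺ˡ as (++-comm qs bs))))) (↭-left as bs qs)

  ↭-bridge : ∀ as bs cs → x ∷ y ∷ as ++ bs ++ cs ↭ (x ∷ as) ++ cs ++ y ∷ bs
  ↭-bridge as bs cs = prep x (↭-trans (↭-sym (shift y as (bs ++ cs)))
    (++⁺ˡ as (↭-trans (prep y (++-comm bs cs)) (↭-sym (shift y cs bs)))))

module _ {v : Vec (Fin n) n} where

  Ann-closed : ∀ {ps qs z} → Ann v ps qs → z ∈ ps ++ qs → v ! z ∈ ps ++ qs
  Ann-closed (bridge {as = as} {bs} {cs} xy yx p) z∈ with ∈-merge⁻ as bs cs z∈
  ... | inj₁ refl        = there (∈-++⁺ʳ as (∈-++⁺ʳ cs (here xy)))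
  ... | inj₂ (inj₁ refl) = here yx
  ... | inj₂ (inj₂ q)    = ∈-resp-↭ (↭-bridge as bs cs) (there (there (NC-closed p q)))
  Ann-closed {qs = qs} (left {as = as} {bs} xy yx p q) z∈ = ∈-resp-↭ (↭-left as bs qs)
    (case ∈-resp-↭ (↭-sym (↭-left as bs qs)) z∈ of λ where
      (here refl)         → there (here xy)
      (there (here refl)) → here yx
      (there (there r))   → there (there (case ∈-++⁻ as r of λ where
        (inj₁ s) → ∈-++⁺ˡ (NC-closed p s)
        (inj₂ s) → ∈-++⁺ʳ as (Ann-closed q s))))
  Ann-closed {qs = qs} (right {as = as} {bs} xy yx p q) z∈ = ∈-resp-↭ (↭-right as bs qs)
    (case ∈-resp-↭ (↭-sym (↭-right as bs qs)) z∈ of λ where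
      (here refl)         → there (here xy)
      (there (here refl)) → here yx
      (there (there r))   → there (there (case ∈-++⁻ (as ++ qs) r of λ where
        (inj₁ s) → ∈-++⁺ˡ (Ann-closed p s)
        (inj₂ s) → ∈-++⁺ʳ (as ++ qs) (NC-closed q s))))

  Ann-cong : ∀ {w ps qs} → (∀ {z} → z ∈ ps ++ qs → v ! z ≡ w ! z) → Ann v ps qs → Ann w ps qs
  Ann-cong eq (bridge {as = as} {bs} {cs} xy yx p) = bridge
    (trans (sym (eq (here refl))) xy)
    (trans (sym (eq (there (∈-++⁺ʳ as (∈-++⁺ʳ cs (here refl)))))) yx)
    (NC-cong (eq ∘ ∈-resp-↭ (↭-bridge as bs cs) ∘ there ∘ there) p)
  Ann-cong {qs = qs} eq (left {as = as} {bs} xy yx p q) = left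
    (trans (sym (eq′ (here refl))) xy) (trans (sym (eq′ (there (here refl)))) yx)
    (NC-cong (eq′ ∘ there ∘ there ∘ ∈-++⁺ˡ) p) (Ann-cong (eq′ ∘ there ∘ there ∘ ∈-++⁺ʳ as) q)
    where eq′ = λ {z} → eq {z} ∘ ∈-resp-↭ (↭-left as bs qs)
  Ann-cong {qs = qs} eq (right {as = as} {bs} xy yx p q) = right
    (trans (sym (eq′ (here refl))) xy) (trans (sym (eq′ (there (here refl)))) yx)
    (Ann-cong (eq′ ∘ there ∘ there ∘ ∈-++⁺ˡ) p) (NC-cong (eq′ ∘ there ∘ there ∘ ∈-++⁺ʳ (as ++ qs)) q)
    where eq′ = λ {z} → eq {z} ∘ ∈-resp-↭ (↭-right as bs qs)

  -- The partner of `x` lies on the second polygon and the letters are distinct, so `left` and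
  -- `right`, which place it on the first, are impossible.
  Ann-bridge⁻ : ∀ {x y as bs cs} → Unique ((x ∷ as) ++ cs ++ y ∷ bs) → v ! x ≡ y →
    Ann v (x ∷ as) (cs ++ y ∷ bs) → v ! y ≡ x × NC v (as ++ bs ++ cs)
  Ann-bridge⁻ {x} {y} {as} {bs} {cs} u xy p = go p refl refl
    where
    y∉as : y ∉ as
    y∉as y∈ = proj₂ (proj₂ (unique-++⁻ (x ∷ as) u)) (there y∈) (∈-++⁺ʳ cs (here refl))
    uq : Unique (cs ++ y ∷ bs)
    uq = proj₁ (proj₂ (unique-++⁻ (x ∷ as) u))
    go : ∀ {ps qs} → Ann v (x ∷ ps) qs → as ≡ ps → cs ++ y ∷ bs ≡ qs → v ! y ≡ x × NC v (as ++ bs ++ cs)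
    go (bridge {cs = ds} xy′ yx p) refl eq with trans (sym xy) xy′
    ... | refl with split-unique cs ds uq eq
    ... | refl , refl = yx , p
    go (left {as = ds} xy′ yx p q) refl refl with trans (sym xy) xy′
    ... | refl = ⊥-elim (y∉as (∈-++⁺ʳ ds (here refl)))
    go (right {as = ds} xy′ yx p q) refl refl with trans (sym xy) xy′
    ... | refl = ⊥-elim (y∉as (∈-++⁺ʳ ds (here refl)))

  Ann-arc⁻ : ∀ {x y as bs qs} → Unique ((x ∷ as ++ y ∷ bs) ++ qs) → v ! x ≡ y →
    Ann v (x ∷ as ++ y ∷ bs) qs → v ! y ≡ x × (NC v as × Ann v bs qs ⊎ Ann v as qs × NC v bs)
  Ann-arc⁻ {x} {y} {as} {bs} {qs} u xy p = go p refl refl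
    where
    y∉qs : y ∉ qs
    y∉qs y∈ = proj₂ (proj₂ (unique-++⁻ (x ∷ as ++ y ∷ bs) u)) (there (∈-++⁺ʳ as (here refl))) y∈
    up : Unique (as ++ y ∷ bs)
    up with proj₁ (unique-++⁻ (x ∷ as ++ y ∷ bs) u)
    ... | _ ∷ up = up
    go : ∀ {ps rs} → Ann v (x ∷ ps) rs → as ++ y ∷ bs ≡ ps → qs ≡ rs →
      v ! y ≡ x × (NC v as × Ann v bs qs ⊎ Ann v as qs × NC v bs)
    go (bridge {cs = ds} xy′ yx p) eq refl with trans (sym xy) xy′
    ... | refl = ⊥-elim (y∉qs (∈-++⁺ʳ ds (here refl)))
    go (left {as = ds} xy′ yx p q) eq refl with trans (sym xy) xy′
    ... | refl with split-unique as ds up eq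
    ... | refl , refl = yx , inj₁ (p , q)
    go (right {as = ds} xy′ yx p q) eq refl with trans (sym xy) xy′
    ... | refl with split-unique as ds up eq
    ... | refl , refl = yx , inj₂ (p , q)

-- Counting pairings by the lengths of the polygons

record Local (F : Vec (Fin n) n → Set) (us : List (Fin n)) : Set where
  field
    respects : ∀ {v w} → (∀ {z} → z ∈ us → v ! z ≡ w ! z) → F v → F w
    closed   : ∀ {v z} → F v → z ∈ us → v ! z ∈ us
open Local

NC-local : (ps : List (Fin n)) → Local (λ v → NC v ps) ps
NC-local ps = record { respects = NC-cong ; closed = λ {v} → NC-closed {v = v} }

Ann-local : (ps qs : List (Fin n)) → Local (λ v → Ann v ps qs) (ps ++ qs)
Ann-local ps qs = record { respects = Ann-cong ; closed = λ {v} → Ann-closed {v = v} }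

⊤-local : Local {n} (λ _ → ⊤) []
⊤-local = record { respects = λ _ _ → tt ; closed = λ _ () }

module _ {n : ℕ} where
  open DecMembership (_≟_ {n}) using (_∈?_)

  restrict : List (Fin n) → Vec (Fin n) n → Vec (Fin n) n
  restrict us v = Vec.tabulate λ z → if does (z ∈? us) then v ! z else z

  restrict-∈ : ∀ {us z} v → z ∈ us → restrict us v ! z ≡ v ! z
  restrict-∈ {us} {z} v z∈ = trans (Vec.lookup∘tabulate _ z) helper
    where
    helper : (if does (z ∈? us) then v ! z else z) ≡ v ! z
    helper with z ∈? us
    ... | yes _ = refl
    ... | no z∉ = ⊥-elim (z∉ z∈)

  restrict-∉ : ∀ {us z} v → z ∉ us → restrict us v ! z ≡ z
  restrict-∉ {us} {z} v z∉ = trans (Vec.lookup∘tabulate _ z) helper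
    where
    helper : (if does (z ∈? us) then v ! z else z) ≡ z
    helper with z ∈? us
    ... | yes z∈ = ⊥-elim (z∉ z∈)
    ... | no _   = refl

  compose : Vec (Fin n) n → Vec (Fin n) n → Vec (Fin n) n
  compose u w = Vec.tabulate λ z → u ! (w ! z)

  -- When `u` and `w` live on disjoint sets of letters, each is the identity on the other's letters,
  -- so the composite acts as `u` on one set and as `w` on the other. The two updates add the arc
  -- between `x` and `y`.
  glue : (x y : Fin n) → Vec (Fin n) n × Vec (Fin n) n → Vec (Fin n) n
  glue x y (u , w) = (compose u w [ x ]≔ y) [ y ]≔ x

  -- Restricting a vector to `us` and to `ws` inverts `glue`. Locality lets `F` and `G` pass between
  -- a vector and its restrictions, so the two parts are chosen independently and the counts
  -- multiply.
  card-glue : ∀ {F G : Vec (Fin n) n → Set} {x y us ws j k} → Unique (x ∷ y ∷ us ++ ws) →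
    Local F us → Local G ws →
    Card (λ v → F v × FixedOff v us) j → Card (λ v → G v × FixedOff v ws) k →
    Card (λ v → v ! x ≡ y × v ! y ≡ x × F v × G v × FixedOff v (x ∷ y ∷ us ++ ws)) (j * k)
  card-glue {F} {G} {x} {y} {us} {ws} (x≢ ∷ y≢ ∷ unique) locF locG c d =
    card-map (glue x y) injective to from (card-× c d)
    where
    x≢y : x ≢ y
    x≢y = All.lookup x≢ (here refl)
    disjoint : ∀ {z} → z ∈ us → z ∉ ws
    disjoint = proj₂ (proj₂ (unique-++⁻ us unique))

    Parts : Vec (Fin n) n × Vec (Fin n) n → Set
    Parts (u , w) = (F u × FixedOff u us) × (G w × FixedOff w ws)

    at-x : ∀ p → glue x y p ! x ≡ y
    at-x (u , w) = trans (Vec.lookup∘update′ x≢y (compose u w [ x ]≔ y) x) (Vec.lookup∘update x (compose u w) y)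
    at-y : ∀ p → glue x y p ! y ≡ x
    at-y (u , w) = Vec.lookup∘update y (compose u w [ x ]≔ y) x
    at-rest : ∀ (p : _ × _) {z} → x ≢ z → y ≢ z → glue x y p ! z ≡ proj₁ p ! (proj₂ p ! z)
    at-rest (u , w) {z} x≢z y≢z = trans (Vec.lookup∘update′ (y≢z ∘ sym) (compose u w [ x ]≔ y) x)
      (trans (Vec.lookup∘update′ (x≢z ∘ sym) (compose u w) y) (Vec.lookup∘tabulate (λ z′ → u ! (w ! z′)) z))
    at-us : ∀ {p z} → Parts p → z ∈ us → glue x y p ! z ≡ proj₁ p ! z
    at-us {u , w} {z} (_ , _ , fix) z∈ = trans
      (at-rest (u , w) (All.lookup x≢ (there (∈-++⁺ˡ z∈))) (All.lookup y≢ (∈-++⁺ˡ z∈)))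
      (cong (u !_) (fix z (disjoint z∈)))
    -- Closedness enters here: `w` keeps `z` inside `ws`, where `u` is the identity.
    at-ws : ∀ {p z} → Parts p → z ∈ ws → glue x y p ! z ≡ proj₂ p ! z
    at-ws {u , w} {z} ((_ , fix) , g , _) z∈ = trans
      (at-rest (u , w) (All.lookup x≢ (there (∈-++⁺ʳ us z∈))) (All.lookup y≢ (∈-++⁺ʳ us z∈)))
      (fix (w ! z) (λ q → disjoint q (closed locG g z∈)))

    injective : ∀ {p q} → Parts p → Parts q → glue x y p ≡ glue x y q → p ≡ q
    injective {u , w} {u′ , w′} ps@((_ , fu) , _ , fw) ps′@((_ , fu′) , _ , fw′) eq =
      cong₂ _,_ (vec-ext same-u) (vec-ext same-w)
      where
      same-u : ∀ z → u ! z ≡ u′ ! z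
      same-u z with z ∈? us
      ... | yes z∈ = trans (sym (at-us ps z∈)) (trans (cong (_! z) eq) (at-us ps′ z∈))
      ... | no z∉  = trans (fu z z∉) (sym (fu′ z z∉))
      same-w : ∀ z → w ! z ≡ w′ ! z
      same-w z with z ∈? ws
      ... | yes z∈ = trans (sym (at-ws ps z∈)) (trans (cong (_! z) eq) (at-ws ps′ z∈))
      ... | no z∉  = trans (fw z z∉) (sym (fw′ z z∉))

    to : ∀ {p} → Parts p → let v = glue x y p in
      v ! x ≡ y × v ! y ≡ x × F v × G v × FixedOff v (x ∷ y ∷ us ++ ws)
    to {p} ps@((f , fu) , g , fw) = at-x p , at-y p
      , respects locF (λ z∈ → sym (at-us ps z∈)) f
      , respects locG (λ z∈ → sym (at-ws ps z∈)) g
      , λ z z∉ → trans (at-rest p (λ eq → z∉ (here (sym eq))) (λ eq → z∉ (there (here (sym eq)))))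
          (trans (cong (proj₁ p !_) (fw z (z∉ ∘ there ∘ there ∘ ∈-++⁺ʳ us)))
                 (fu z (z∉ ∘ there ∘ there ∘ ∈-++⁺ˡ)))

    from : ∀ {v} → v ! x ≡ y × v ! y ≡ x × F v × G v × FixedOff v (x ∷ y ∷ us ++ ws) →
      ∃ λ p → Parts p × v ≡ glue x y p
    from {v} (vx , vy , f , g , fix) = p , parts , vec-ext same
      where
      p = restrict us v , restrict ws v
      parts : Parts p
      parts = (respects locF (λ z∈ → sym (restrict-∈ v z∈)) f , λ z → restrict-∉ v)
            , (respects locG (λ z∈ → sym (restrict-∈ v z∈)) g , λ z → restrict-∉ v)
      same : ∀ z → v ! z ≡ glue x y p ! z
      same z with z ∈? (x ∷ y ∷ us ++ ws)
      ... | no z∉                  = trans (fix z z∉) (sym (proj₂ (proj₂ (proj₂ (proj₂ (to parts)))) z z∉))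
      ... | yes (here refl)         = trans vx (sym (at-x p))
      ... | yes (there (here refl)) = trans vy (sym (at-y p))
      ... | yes (there (there z∈)) with ∈-++⁻ us z∈
      ... | inj₁ z∈us = sym (trans (at-us parts z∈us) (restrict-∈ v z∈us))
      ... | inj₂ z∈ws = sym (trans (at-ws parts z∈ws) (restrict-∈ v z∈ws))

  card-identity : Card (λ (v : Vec (Fin n) n) → FixedOff v []) 1
  card-identity = card-⇔
    (λ { refl z _ → Vec.lookup∘tabulate _ z })
    (λ fix → vec-ext λ z → trans (Vec.lookup∘tabulate _ z) (sym (fix z λ ())))
    (card-singleton (Vec.tabulate λ z → z))

-- The first argument bounds the recursion depth.
nc : ℕ → ℕ → ℕ
nc f       zero    = 1
nc zero    (suc p) = 0
nc (suc f) (suc p) = conv (λ a b → nc f a * nc f b) p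

-- In the first sum the first letter is joined to its own polygon, with `a` letters inside the arc
-- and `b` behind it; in the second it is joined to the other polygon, and the merged polygon keeps
-- `p + (b + c)` letters. An empty first polygon has no crossing edge, so the first zero is a
-- genuine count; the zero at exhausted depth is a default that the bounds in `card-Ann` exclude.
ann : ℕ → ℕ → ℕ → ℕ
ann f       zero    q = 0
ann zero    (suc p) q = 0
ann (suc f) (suc p) q =
  conv (λ a b → nc f a * ann f b q + ann f a q * nc f b) p +
  conv (λ c b → nc f (p + (b + c))) q

length-≤ˡ : ∀ (as : List A) {y bs} → length as ≤ length (as ++ y ∷ bs)
length-≤ˡ as = length-++-≤ˡ as

length-≤ʳ : ∀ (as : List A) {y bs} → length bs ≤ length (as ++ y ∷ bs)
length-≤ʳ as {y} {bs} = ≤-trans (n≤1+n _) (length-++-≤ʳ (y ∷ bs) {as})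

tail-unique : {z : A} {zs : List A} → Unique (z ∷ zs) → Unique zs
tail-unique (_ ∷ u) = u

-- Once the partner of the first letter is chosen, the two sides are paired independently, and by
-- induction only their lengths matter. The recursion is on `f` because the two sides are not
-- structural parts of the list.
card-NC : ∀ f (ps : List (Fin n)) → length ps ≤ f → Unique ps →
  Card (λ v → NC v ps × FixedOff v ps) (nc f (length ps))
card-NC f       []       _         _ = card-⇔ ([] ,_) proj₂ card-identity
card-NC (suc f) (x ∷ ps) (s≤s ps≤) u@(_ ∷ ups) = card-⇔
  (λ { (_ , _ , _ , r) → r })
  (λ {v} r@(p , _) → v ! x , x-partner p , refl , r)
  (card-splits {S = λ y v → v ! x ≡ y × NC v (x ∷ ps) × FixedOff v (x ∷ ps)} _ ps ups
    (λ { (eq , _) (eq′ , _) → trans (sym eq) eq′ })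
    λ { as y bs refl → card-⇔
      (λ {v} (xy , yx , p , q , fix) → xy , arc xy yx p q , FixedOff-↭ v (↭-arc as bs) fix)
      (λ {v} (xy , p , fix) → let yx , p₁ , p₂ = NC-arc⁻ ups xy p in
        xy , yx , p₁ , p₂ , FixedOff-↭ v (↭-sym (↭-arc as bs)) fix)
      (card-glue (unique-resp-↭ (↭-sym (↭-arc as bs)) u) (NC-local as) (NC-local bs)
        (card-NC f as (≤-trans (length-≤ˡ as) ps≤)
          (proj₁ (unique-++⁻ as ups)))
        (card-NC f bs (≤-trans (length-≤ʳ as) ps≤)
          (tail-unique (proj₁ (proj₂ (unique-++⁻ as ups)))))) })
  where
  x-partner : ∀ {v} → NC v (x ∷ ps) → v ! x ∈ ps
  x-partner (arc {as = as} xy _ _ _) = ∈-++⁺ʳ as (here xy)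

card-Ann : ∀ f (ps qs : List (Fin n)) → length ps + length qs ≤ f → Unique (ps ++ qs) →
  Card (λ v → Ann v ps qs × FixedOff v (ps ++ qs)) (ann f (length ps) (length qs))
card-Ann f       []       qs _         _ = card-⊥ λ ()
card-Ann (suc f) (x ∷ ps) qs (s≤s pq≤) u@(_ ∷ u′) = card-⇔
  (λ { (inj₁ (_ , _ , _ , r)) → r ; (inj₂ (_ , _ , _ , r)) → r })
  (λ {v} r@(p , _) → case x-partner p of λ where
    (inj₁ y∈) → inj₁ (v ! x , y∈ , refl , r)
    (inj₂ y∈) → inj₂ (v ! x , y∈ , refl , r))
  (card-⊎ (λ { (_ , y∈ , eq , _) (_ , y∈′ , eq′ , _) →
               disjoint y∈ (subst (_∈ qs) (trans (sym eq′) eq) y∈′) })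
    (card-splits {S = S} _ ps ups (λ { (eq , _) (eq′ , _) → trans (sym eq) eq′ }) same)
    (card-splits {S = S} _ qs uqs (λ { (eq , _) (eq′ , _) → trans (sym eq) eq′ }) other))
  where
  S : Fin _ → Vec (Fin _) _ → Set
  S y v = v ! x ≡ y × Ann v (x ∷ ps) qs × FixedOff v (x ∷ ps ++ qs)
  ups = proj₁ (unique-++⁻ ps u′)
  uqs = proj₁ (proj₂ (unique-++⁻ ps u′))
  disjoint = proj₂ (proj₂ (unique-++⁻ ps u′))

  x-partner : ∀ {v} → Ann v (x ∷ ps) qs → v ! x ∈ ps ⊎ v ! x ∈ qs
  x-partner (bridge {cs = cs} xy _ _) = inj₂ (∈-++⁺ʳ cs (here xy))
  x-partner (left {as = as} xy _ _ _) = inj₁ (∈-++⁺ʳ as (here xy))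
  x-partner (right {as = as} xy _ _ _) = inj₁ (∈-++⁺ʳ as (here xy))

  same : ∀ as y bs → as ++ y ∷ bs ≡ ps → Card (S y)
    (nc f (length as) * ann f (length bs) (length qs) + ann f (length as) (length qs) * nc f (length bs))
  same as y bs refl = card-⇔
    (λ {v} → λ { (inj₁ (xy , yx , p , q , fix)) → xy , left xy yx p q , FixedOff-↭ v (↭-left as bs qs) fix
               ; (inj₂ (xy , yx , p , q , fix)) → xy , right xy yx p q , FixedOff-↭ v (↭-right as bs qs) fix })
    (λ {v} (xy , p , fix) → case Ann-arc⁻ u xy p of λ where
      (yx , inj₁ (p₁ , p₂)) → inj₁ (xy , yx , p₁ , p₂ , FixedOff-↭ v (↭-sym (↭-left as bs qs)) fix)
      (yx , inj₂ (p₁ , p₂)) → inj₂ (xy , yx , p₁ , p₂ , FixedOff-↭ v (↭-sym (↭-right as bs qs)) fix))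
    -- The two alternatives exclude each other: in one `as` is closed, in the other an edge leads
    -- from `as` to `qs`.
    (card-⊎ (λ { (_ , _ , p , _) (_ , _ , q , _) →
                 let z , z∈ , vz∈ = Ann-crosses q in disjoint (∈-++⁺ˡ (NC-closed p z∈)) vz∈ })
      (card-glue u₁ (NC-local as) (Ann-local bs qs)
        (card-NC f as (≤-trans (m≤m+n _ _) as≤) (proj₁ (unique-++⁻ as (tail₂ u₁))))
        (card-Ann f bs qs bs≤ (proj₁ (proj₂ (unique-++⁻ as (tail₂ u₁))))))
      (card-glue u₂ (Ann-local as qs) (NC-local bs)
        (card-Ann f as qs as≤ (proj₁ (unique-++⁻ (as ++ qs) (tail₂ u₂))))
        (card-NC f bs (≤-trans (m≤m+n _ _) bs≤) (proj₁ (proj₂ (unique-++⁻ (as ++ qs) (tail₂ u₂)))))))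
    where
    as≤ : length as + length qs ≤ f
    as≤ = ≤-trans (+-monoˡ-≤ (length qs) (length-≤ˡ as)) pq≤
    bs≤ : length bs + length qs ≤ f
    bs≤ = ≤-trans (+-monoˡ-≤ (length qs) (length-≤ʳ as)) pq≤
    u₁ = unique-resp-↭ (↭-sym (↭-left as bs qs)) u
    u₂ = unique-resp-↭ (↭-sym (↭-right as bs qs)) u
    tail₂ : ∀ {y z : Fin _} {zs} → Unique (y ∷ z ∷ zs) → Unique zs
    tail₂ = tail-unique ∘ tail-unique

  other : ∀ cs y bs → cs ++ y ∷ bs ≡ qs → Card (S y) (nc f (length ps + (length bs + length cs)))
  other cs y bs refl = subst (Card (S y))
    (trans (*-identityʳ _) (cong (nc f) length-parts))
    (card-⇔
      (λ {v} (xy , yx , p , _ , fix) → xy , bridge xy yx p , FixedOff-↭ v perm fix)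
      (λ {v} (xy , p , fix) → let yx , p₁ = Ann-bridge⁻ u xy p in
        xy , yx , p₁ , tt , FixedOff-↭ v (↭-sym perm) fix)
      -- There is only one part here, the merged polygon; the second one is empty and contributes
      -- the factor 1.
      (card-glue u₁ (NC-local (ps ++ bs ++ cs)) ⊤-local
        (card-NC f (ps ++ bs ++ cs) (≤-trans (≤-trans (≤-reflexive length-parts) (+-monoʳ-≤ (length ps) bc≤)) pq≤) (proj₁ (unique-++⁻ (ps ++ bs ++ cs) (tail-unique (tail-unique u₁)))))
        (card-⇔ (tt ,_) proj₂ card-identity)))
    where
    perm : x ∷ y ∷ (ps ++ bs ++ cs) ++ [] ↭ x ∷ ps ++ cs ++ y ∷ bs
    perm = ↭-trans (↭-reflexive (++-identityʳ _)) (↭-bridge ps bs cs)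
    u₁ = unique-resp-↭ (↭-sym perm) u
    length-parts : length (ps ++ bs ++ cs) ≡ length ps + (length bs + length cs)
    length-parts = trans (length-++ ps) (cong (length ps +_) (length-++ bs))
    bc≤ : length bs + length cs ≤ length qs
    bc≤ = ≤-trans (≤-reflexive (+-comm (length bs) (length cs)))
      (≤-trans (+-monoʳ-≤ (length cs) (n≤1+n _)) (≤-reflexive (sym (length-++ cs))))

-- Cycles of permutations as explicit lists

-- The end `z` is not among the listed letters. A cycle is then a path back to its start, and
-- cutting a cycle at a letter gives two paths.
Path : (Fin n → Fin n) → Fin n → List (Fin n) → Fin n → Set
Path τ x []       z = τ x ≡ z
Path τ x (y ∷ ys) z = τ x ≡ y × Path τ y ys z

IsCycle : (Fin n → Fin n) → List (Fin n) → Set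
IsCycle τ []       = ⊥
IsCycle τ (x ∷ xs) = Path τ x xs x

module _ {τ : Fin n → Fin n} where

  path-++⁺ : ∀ {x y z} as {bs} → Path τ x as y → Path τ y bs z → Path τ x (as ++ y ∷ bs) z
  path-++⁺ []       p       q = p , q
  path-++⁺ (a ∷ as) (e , p) q = e , path-++⁺ as p q

  path-++⁻ : ∀ {x y z} as {bs} → Path τ x (as ++ y ∷ bs) z → Path τ x as y × Path τ y bs z
  path-++⁻ []       (e , p) = e , p
  path-++⁻ (a ∷ as) (e , p) = let q , r = path-++⁻ as p in (e , q) , r

  -- The start may change, as it does when an edge is deleted: its two ends exchange successors, so
  -- what followed one end now follows the other.
  path-reroute : ∀ {τ′ x x′ z} xs → τ x ≡ τ′ x′ → (∀ {w} → w ∈ xs → τ w ≡ τ′ w) →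
    Path τ x xs z → Path τ′ x′ xs z
  path-reroute []       e h p       = trans (sym e) p
  path-reroute (y ∷ ys) e h (q , p) = trans (sym e) q , path-reroute ys (h (here refl)) (h ∘ there) p

  rotate : ∀ as {x bs} → IsCycle τ (as ++ x ∷ bs) → IsCycle τ (x ∷ bs ++ as)
  rotate []                p = subst (λ l → Path τ _ l _) (sym (++-identityʳ _)) p
  rotate (a ∷ as) {bs = bs} p = let q , r = path-++⁻ as p in path-++⁺ bs r q

  path-image : ∀ {x y z} xs → Path τ x xs z → y ∈ x ∷ xs → τ y ∈ xs ⊎ τ y ≡ z
  path-image []       e       (here refl) = inj₂ e
  path-image (w ∷ ws) (e , p) (here refl) = inj₁ (here e)
  path-image (w ∷ ws) (e , p) (there y∈) with path-image ws p y∈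
  ... | inj₁ q = inj₁ (there q)
  ... | inj₂ q = inj₂ q

  cycle-closed : ∀ {ps y} → IsCycle τ ps → y ∈ ps → τ y ∈ ps
  cycle-closed {x ∷ xs} c y∈ with path-image xs c y∈
  ... | inj₁ q = there q
  ... | inj₂ q = here q

  iter-closed : ∀ {ps y} k → IsCycle τ ps → y ∈ ps → iter k τ y ∈ ps
  iter-closed zero    c y∈ = y∈
  iter-closed (suc k) c y∈ = cycle-closed c (iter-closed k c y∈)

  iter-suc : ∀ k x → iter (suc k) τ x ≡ iter k τ (τ x)
  iter-suc zero    x = refl
  iter-suc (suc k) x = cong τ (iter-suc k x)

  path-reaches : ∀ {x y z} xs → Path τ x xs z → y ∈ x ∷ xs → ∃ λ k → k ≤ length xs × iter k τ x ≡ y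
  path-reaches xs       p          (here refl) = 0 , z≤n , refl
  path-reaches {x} (w ∷ ws) (refl , p) (there y∈) = let k , k≤ , eq = path-reaches ws p y∈ in
    suc k , s≤s k≤ , trans (iter-suc k x) eq

  cycle-reaches : ∀ {ps x y} → IsCycle τ ps → x ∈ ps → y ∈ ps →
    ∃ λ k → k < length ps × iter k τ x ≡ y
  cycle-reaches {x = x} c x∈ y∈ with ∈-∃++ x∈
  ... | as , bs , refl =
    let k , k≤ , eq = path-reaches (bs ++ as) (rotate as c) (∈-resp-↭ rot y∈)
    in k , subst (k <_) (sym (↭-length rot)) (s≤s k≤) , eq
    where
    rot : as ++ x ∷ bs ↭ x ∷ bs ++ as
    rot = ++-comm as (x ∷ bs)

minimum : ∀ x (xs : List (Fin n)) → ∃ λ m → m ∈ x ∷ xs × (∀ {y} → y ∈ x ∷ xs → toℕ m ≤ toℕ y)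
minimum x []       = x , here refl , λ { (here refl) → ≤-refl }
minimum x (y ∷ ys) with minimum y ys
... | m , m∈ , m≤ with ≤-total (toℕ x) (toℕ m)
... | inj₁ x≤m = x , here refl , λ { (here refl) → ≤-refl ; (there z∈) → ≤-trans x≤m (m≤ z∈) }
... | inj₂ m≤x = m , there m∈ , λ { (here refl) → m≤x ; (there z∈) → m≤ z∈ }

unique-length : {ps : List (Fin n)} → Unique ps → length ps ≤ n
unique-length {n} u = ≤-trans (⊆-length u (λ {z} _ → ∈-allFin z)) (≤-reflexive (length-tabulate (λ z → z)))

-- Any letter passing the test reaches the minimum `m` in fewer steps than the cycle has letters,
-- hence in fewer than `n`. So the bounded test of `IsCycleMin` sees `m`, and the letter must be `m`
-- itself.
cycle-one-min : (σ : Fin n → Fin n) (ps : List (Fin n)) → IsCycle σ ps → Unique ps →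
  length (filter (isCycleMin? σ) ps) ≡ 1
cycle-one-min σ ps@(x ∷ xs) c u with minimum x xs
... | m , m∈ , m≤ = card-unique
  (card-filter (isCycleMin? σ) ps u
    (λ a∈ a-min → toℕ-injective (≤-antisym (m≤ a∈) (below a∈ a-min)))
    (λ { refl → m∈ , λ k → m≤ (iter-closed (toℕ k) c m∈) }))
  (card-singleton m)
  where
  below : ∀ {a} → a ∈ ps → IsCycleMin σ a → toℕ a ≤ toℕ m
  below {a} a∈ a-min =
    let k , k< , eq = cycle-reaches c a∈ m∈
        k<n = ≤-trans k< (unique-length u)
    in subst (λ z → toℕ a ≤ toℕ z)
         (trans (cong (λ j → iter j σ a) (toℕ-fromℕ< k<n)) eq) (a-min (fromℕ< k<n))

numCycles-cycles : (σ : Fin n → Fin n) (pss : List (List (Fin n))) →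
  All (IsCycle σ) pss → concat pss ↭ allFin n → numCycles σ ≡ length pss
numCycles-cycles {n} σ pss cycles covers =
  trans (↭-length (filter-↭ (isCycleMin? σ) (↭-sym covers)))
        (go pss cycles (unique-resp-↭ (↭-sym covers) (Unique.allFin⁺ n)))
  where
  go : ∀ qss → All (IsCycle σ) qss → Unique (concat qss) →
    length (filter (isCycleMin? σ) (concat qss)) ≡ length qss
  go []         []       u = refl
  go (ps ∷ qss) (c ∷ cs) u = let u₁ , u₂ , _ = unique-++⁻ ps u in
    trans (cong length (filter-++ (isCycleMin? σ) ps (concat qss)))
      (trans (length-++ (filter (isCycleMin? σ) ps))
        (cong₂ _+_ (cycle-one-min σ ps c u₁) (go qss cs u₂)))

-- Deleting an edge

∈⇒↭ : {x : A} {xs : List A} → x ∈ xs → ∃ λ ys → xs ↭ x ∷ ys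
∈⇒↭ x∈ with ∈-∃++ x∈
... | as , bs , refl = as ++ bs , shift _ as bs

concat-↭ : {pss qss : List (List A)} → pss ↭ qss → concat pss ↭ concat qss
concat-↭ ↭.refl          = ↭-refl
concat-↭ (prep ps p)     = ++⁺ˡ ps (concat-↭ p)
concat-↭ (swap ps qs p)  = ↭-trans (shifts ps qs) (++⁺ˡ qs (++⁺ˡ ps (concat-↭ p)))
concat-↭ (↭.trans p q)   = ↭-trans (concat-↭ p) (concat-↭ q)

live? : (v : Vec (Fin n) n) → Decidable (λ z → v ! z ≢ z)
live? v z = ¬? (v ! z ≟ z)

live : Vec (Fin n) n → List (Fin n) → List (Fin n)
live v = filter (live? v)

NCLive : Vec (Fin n) n → List (Fin n) → Set
NCLive v ps = NC v (live v ps)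

kill : Vec (Fin n) n → Fin n → Fin n → Vec (Fin n) n
kill v x y = (v [ x ]≔ x) [ y ]≔ y

-- The transposition of `x` and `y` is applied before `τ`. If `x` and `y` are partners, `kill v x y`
-- is `v` followed by the same transposition, and the two cancel in the product with `τ`.
reroute : (Fin n → Fin n) → Fin n → Fin n → Fin n → Fin n
reroute τ x y z = if does (z ≟ x) then τ y else if does (z ≟ y) then τ x else τ z

module _ (v : Vec (Fin n) n) where

  live-++ : ∀ as bs → live v (as ++ bs) ≡ live v as ++ live v bs
  live-++ as bs = filter-++ (live? v) as bs

  live-alive : ∀ {x xs} → v ! x ≢ x → live v (x ∷ xs) ≡ x ∷ live v xs
  live-alive = filter-accept (live? v)

  live-dead : ∀ {x xs} → v ! x ≡ x → live v (x ∷ xs) ≡ live v xs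
  live-dead eq = filter-reject (live? v) (λ ¬eq → ¬eq eq)

  ∈-live⁺ : ∀ {z ps} → z ∈ ps → v ! z ≢ z → z ∈ live v ps
  ∈-live⁺ = ∈-filter⁺ (live? v)

  ∈-live⁻ : ∀ {z ps} → z ∈ live v ps → z ∈ ps
  ∈-live⁻ z∈ = proj₁ (∈-filter⁻ (live? v) z∈)

  live-unique : ∀ {ps} → Unique ps → Unique (live v ps)
  live-unique = Unique.filter⁺ (live? v)

  -- Only dead letters move to the back, so the list of live letters is literally unchanged, and
  -- with it `NCLive` and `AnnLive`. The induction can thus always start at a live first letter.
  live-rotate : ∀ ds {x xs} → live v ds ≡ [] → live v (x ∷ xs ++ ds) ≡ live v (ds ++ x ∷ xs)
  live-rotate ds {x} {xs} eq = trans (live-++ (x ∷ xs) ds) (trans (cong (live v (x ∷ xs) ++_) eq)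
    (trans (++-identityʳ _) (sym (trans (live-++ ds (x ∷ xs)) (cong (_++ live v (x ∷ xs)) eq)))))

  first-live : ∀ {z} ps → z ∈ ps → v ! z ≢ z →
    ∃ λ ds → ∃₂ λ x xs → ps ≡ ds ++ x ∷ xs × live v ds ≡ [] × v ! x ≢ x
  first-live (p ∷ ps) z∈ z-live with v ! p ≟ p
  ... | no p-live = [] , p , ps , refl , refl , p-live
  first-live (p ∷ ps) (here refl) z-live | yes p-dead = ⊥-elim (z-live p-dead)
  first-live (p ∷ ps) (there z∈)    z-live | yes p-dead with first-live ps z∈ z-live
  ... | ds , x , xs , eq , dead , x-live = p ∷ ds , x , xs , cong (p ∷_) eq , trans (live-dead p-dead) dead , x-live

module _ (v w : Vec (Fin n) n) where

  live-agree : ∀ ps → (∀ {z} → z ∈ ps → v ! z ≡ w ! z) → live v ps ≡ live w ps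
  live-agree []       eq = refl
  live-agree (p ∷ ps) eq with v ! p ≟ p
  ... | yes dead = trans (live-agree ps (eq ∘ there)) (sym (live-dead w (trans (sym (eq (here refl))) dead)))
  ... | no alive = trans (cong (p ∷_) (live-agree ps (eq ∘ there)))
                         (sym (live-alive w (λ e → alive (trans (eq (here refl)) e))))

  NCLive-agree : ∀ ps → (∀ {z} → z ∈ ps → v ! z ≡ w ! z) → NCLive v ps → NCLive w ps
  NCLive-agree ps eq p = subst (NC w) (live-agree ps eq) (NC-cong (eq ∘ ∈-live⁻ v) p)

  NCLive-agree-all : ∀ pss → (∀ {z} → z ∈ concat pss → v ! z ≡ w ! z) → All (NCLive v) pss → All (NCLive w) pss
  NCLive-agree-all []         eq []       = []
  NCLive-agree-all (ps ∷ pss) eq (p ∷ pp) =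
    NCLive-agree ps (eq ∘ ∈-++⁺ˡ) p ∷ NCLive-agree-all pss (eq ∘ ∈-++⁺ʳ ps) pp

module _ (v : Vec (Fin n) n) {x y : Fin n} (x≢y : x ≢ y) where

  kill-x : kill v x y ! x ≡ x
  kill-x = trans (Vec.lookup∘update′ x≢y (v [ x ]≔ x) y) (Vec.lookup∘update x v x)

  kill-y : kill v x y ! y ≡ y
  kill-y = Vec.lookup∘update y (v [ x ]≔ x) y

  kill-rest : ∀ {z} → z ≢ x → z ≢ y → v ! z ≡ kill v x y ! z
  kill-rest z≢x z≢y = sym (trans (Vec.lookup∘update′ z≢y (v [ x ]≔ x) y) (Vec.lookup∘update′ z≢x v x))

  kill-agree : ∀ {ps} → x ∉ ps → y ∉ ps → ∀ {z} → z ∈ ps → v ! z ≡ kill v x y ! z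
  kill-agree x∉ y∉ z∈ = kill-rest (λ { refl → x∉ z∈ }) (λ { refl → y∉ z∈ })

module _ (τ : Fin n → Fin n) (x y : Fin n) where

  reroute-x : reroute τ x y x ≡ τ y
  reroute-x with x ≟ x
  ... | yes _  = refl
  ... | no x≢x = ⊥-elim (x≢x refl)

  reroute-y : reroute τ x y y ≡ τ x
  reroute-y with y ≟ x
  ... | yes refl = refl
  ... | no _ with y ≟ y
  ... | yes _  = refl
  ... | no y≢y = ⊥-elim (y≢y refl)

  reroute-rest : ∀ {z} → z ≢ x → z ≢ y → reroute τ x y z ≡ τ z
  reroute-rest {z} z≢x z≢y with z ≟ x
  ... | yes z≡x = ⊥-elim (z≢x z≡x)
  ... | no _ with z ≟ y
  ... | yes z≡y = ⊥-elim (z≢y z≡y)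
  ... | no _    = refl

  reroute-path : ∀ {s s′ z} as → x ∉ as → y ∉ as → reroute τ x y s′ ≡ τ s →
    Path τ s as z → Path (reroute τ x y) s′ as z
  reroute-path as x∉ y∉ eq = path-reroute as (sym eq)
    λ w∈ → sym (reroute-rest (λ { refl → x∉ w∈ }) (λ { refl → y∉ w∈ }))

  reroute-cycles : ∀ pss → x ∉ concat pss → y ∉ concat pss →
    All (IsCycle τ) pss → All (IsCycle (reroute τ x y)) pss
  reroute-cycles []               x∉ y∉ []       = []
  reroute-cycles ((p ∷ ps) ∷ pss) x∉ y∉ (c ∷ cs) =
    reroute-path ps (x∉ ∘ ∈-++⁺ˡ ∘ there) (y∉ ∘ ∈-++⁺ˡ ∘ there)
      (reroute-rest (λ { refl → x∉ (here refl) }) (λ { refl → y∉ (here refl) })) c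
    ∷ reroute-cycles pss (x∉ ∘ ∈-++⁺ʳ (p ∷ ps)) (y∉ ∘ ∈-++⁺ʳ (p ∷ ps)) cs

-- A state of the deletion process: `σ` is kept while the involution, `τ`, the polygons and `N`
-- change. Fixed points of `v` are the dead letters, so that `N` is half the number of live ones.
record Gluing (σ : Fin n → Fin n) (v : Vec (Fin n) n) (τ : Fin n → Fin n)
              (pss : List (List (Fin n))) (N : ℕ) : Set where
  field
    involutive : ∀ z → v ! (v ! z) ≡ z
    factor     : ∀ z → τ (v ! z) ≡ σ z
    edges      : length (live v (allFin n)) ≡ N + N
    cycles     : All (IsCycle τ) pss
    covers     : concat pss ↭ allFin n
open Gluing

module _ {σ : Fin n → Fin n} {v : Vec (Fin n) n} {τ : Fin n → Fin n} where

  gluing-unique : ∀ {pss N} → Gluing σ v τ pss N → Unique (concat pss)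
  gluing-unique g = unique-resp-↭ (↭-sym (covers g)) (Unique.allFin⁺ n)

  gluing-∈ : ∀ {pss N} z → Gluing σ v τ pss N → z ∈ concat pss
  gluing-∈ z g = ∈-resp-↭ (↭-sym (covers g)) (∈-allFin z)

  gluing-↭ : ∀ {pss qss N} → pss ↭ qss → Gluing σ v τ pss N → Gluing σ v τ qss N
  gluing-↭ p g = record
    { involutive = involutive g ; factor = factor g ; edges = edges g
    ; cycles     = All-resp-↭ p (cycles g)
    ; covers     = ↭-trans (↭-sym (concat-↭ p)) (covers g) }

  gluing-rotate : ∀ as {x bs pss N} → Gluing σ v τ ((as ++ x ∷ bs) ∷ pss) N → Gluing σ v τ ((x ∷ bs ++ as) ∷ pss) N
  gluing-rotate as {x} {bs} {pss} g = record
    { involutive = involutive g ; factor = factor g ; edges = edges g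
    ; cycles     = case cycles g of λ { (c ∷ cs) → rotate as c ∷ cs }
    ; covers     = ↭-trans (++⁺ʳ (concat pss) (++-comm (x ∷ bs) as)) (covers g) }

  edges-kill : ∀ {x y N} → v ! x ≡ y → v ! y ≡ x → x ≢ y →
    length (live v (allFin n)) ≡ suc N + suc N → length (live (kill v x y) (allFin n)) ≡ N + N
  edges-kill {x} {y} {N} xy yx x≢y eq with ∈⇒↭ (∈-allFin x)
  ... | rs , p with ∈-resp-↭ p (∈-allFin y)
  ... | here y≡x = ⊥-elim (x≢y (sym y≡x))
  ... | there y∈ with ∈⇒↭ y∈
  ... | zs , q = trans (trans count′ (sym (cong length (live-agree v (kill v x y) zs (kill-agree v x≢y x∉ y∉)))))
    (suc-injective (suc-injective (trans (sym count) (trans eq (cong suc (+-suc N N))))))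
    where
    perm : allFin n ↭ x ∷ y ∷ zs
    perm = ↭-trans p (prep x q)
    u : Unique (x ∷ y ∷ zs)
    u = unique-resp-↭ perm (Unique.allFin⁺ n)
    x∉ : x ∉ zs
    x∉ = head∉ u ∘ there
    y∉ : y ∉ zs
    y∉ = head∉ (tail-unique u)
    count : length (live v (allFin n)) ≡ suc (suc (length (live v zs)))
    count = trans (↭-length (filter-↭ (live? v) perm)) (cong length
      (trans (live-alive v {xs = y ∷ zs} (λ e → x≢y (trans (sym e) xy)))
             (cong (x ∷_) (live-alive v {xs = zs} (λ e → x≢y (trans (sym yx) e))))))
    count′ : length (live (kill v x y) (allFin n)) ≡ length (live (kill v x y) zs)
    count′ = trans (↭-length (filter-↭ (live? (kill v x y)) perm)) (cong length
      (trans (live-dead (kill v x y) {xs = y ∷ zs} (kill-x v x≢y)) (live-dead (kill v x y) {xs = zs} (kill-y v x≢y))))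

  gluing-kill : ∀ {pss qss N x} → Gluing σ v τ pss (suc N) → v ! x ≢ x →
    let y = v ! x ; τ′ = reroute τ x y in
    All (IsCycle τ′) qss → concat qss ↭ concat pss → Gluing σ (kill v x y) τ′ qss N
  gluing-kill {x = x} g x-live cs p = record
    { involutive = inv
    ; factor     = fac
    ; edges      = edges-kill refl yx x≢y (edges g)
    ; cycles     = cs
    ; covers     = ↭-trans p (covers g) }
    where
    y = v ! x
    v′ = kill v x y
    τ′ = reroute τ x y
    yx : v ! y ≡ x
    yx = involutive g x
    x≢y : x ≢ y
    x≢y = x-live ∘ sym
    image≢ : ∀ {z a b} → v ! b ≡ a → z ≢ a → v ! z ≢ b
    image≢ {z} ba z≢a eq = z≢a (trans (sym (involutive g z)) (trans (cong (v !_) eq) ba))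
    inv : ∀ z → v′ ! (v′ ! z) ≡ z
    inv z with z ≟ x | z ≟ y
    ... | yes refl | _          = trans (cong (v′ !_) (kill-x v x≢y)) (kill-x v x≢y)
    ... | no _       | yes refl = trans (cong (v′ !_) (kill-y v x≢y)) (kill-y v x≢y)
    ... | no z≢x     | no z≢y     = trans (cong (v′ !_) (sym (kill-rest v x≢y z≢x z≢y)))
      (trans (sym (kill-rest v x≢y (image≢ refl z≢y) (image≢ yx z≢x))) (involutive g z))
    fac : ∀ z → τ′ (v′ ! z) ≡ σ z
    fac z with z ≟ x | z ≟ y
    ... | yes refl | _          = trans (cong τ′ (kill-x v x≢y)) (trans (reroute-x τ z y) (factor g z))
    ... | no _       | yes refl = trans (cong τ′ (kill-y v x≢y))
      (trans (reroute-y τ x y) (trans (cong τ (sym yx)) (factor g z)))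
    ... | no z≢x     | no z≢y     = trans (cong τ′ (sym (kill-rest v x≢y z≢x z≢y)))
      (trans (reroute-rest τ x y (image≢ refl z≢y) (image≢ yx z≢x)) (factor g z))

  -- With successors exchanged, `y` is followed by `as`, whose end still leads to `y`, and `x` by
  -- `bs`, whose end still leads to `x`.
  gluing-split : ∀ {x as bs pss N} → v ! x ≢ x → let y = v ! x in
    Gluing σ v τ ((x ∷ as ++ y ∷ bs) ∷ pss) (suc N) →
    Gluing σ (kill v x y) (reroute τ x y) ((y ∷ as) ∷ (x ∷ bs) ∷ pss) N
  gluing-split {x} {as} {bs} {pss} x-live g =
    gluing-kill g x-live new perm
    where
    y = v ! x
    perm : (y ∷ as) ++ (x ∷ bs) ++ concat pss ↭ (x ∷ as ++ y ∷ bs) ++ concat pss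
    perm = ↭-trans (↭-trans (↭-reflexive (cong (y ∷_) (sym (++-assoc as (x ∷ bs) (concat pss)))))
        (++⁺ʳ (concat pss) (prep y (shift x as bs))))
      (++⁺ʳ (concat pss) (↭-trans (swap y x ↭-refl) (↭-arc as bs)))
    u : Unique (y ∷ as ++ (x ∷ bs ++ concat pss))
    u = unique-resp-↭ (↭-sym perm) (gluing-unique g)
    y∉ : y ∉ as ++ x ∷ bs ++ concat pss
    y∉ = head∉ u
    parts = unique-++⁻ as (tail-unique u)
    x∉ : x ∉ bs ++ concat pss
    x∉ = head∉ (proj₁ (proj₂ parts))
    new : All (IsCycle (reroute τ x y)) ((y ∷ as) ∷ (x ∷ bs) ∷ pss)
    new with cycles g
    ... | c ∷ cs = let p , q = path-++⁻ as c in
      reroute-path τ x y as (λ x∈ → proj₂ (proj₂ parts) x∈ (here refl)) (y∉ ∘ ∈-++⁺ˡ) (reroute-y τ x y) p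
      ∷ reroute-path τ x y bs (x∉ ∘ ∈-++⁺ˡ) (y∉ ∘ ∈-++⁺ʳ as ∘ there ∘ ∈-++⁺ˡ) (reroute-x τ x y) q
      ∷ reroute-cycles τ x y pss (x∉ ∘ ∈-++⁺ʳ bs) (y∉ ∘ ∈-++⁺ʳ as ∘ there ∘ ∈-++⁺ʳ bs) cs

  -- With successors exchanged, `y` is followed by `as`, which leads to `x`, and `x` by `bs`, which
  -- leads back to `y`.
  gluing-merge : ∀ {x as bs pss N} → v ! x ≢ x → let y = v ! x in
    Gluing σ v τ ((x ∷ as) ∷ (y ∷ bs) ∷ pss) (suc N) →
    Gluing σ (kill v x y) (reroute τ x y) ((y ∷ as ++ x ∷ bs) ∷ pss) N
  gluing-merge {x} {as} {bs} {pss} x-live g =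
    gluing-kill g x-live new perm
    where
    y = v ! x
    perm : (y ∷ as ++ x ∷ bs) ++ concat pss ↭ (x ∷ as) ++ (y ∷ bs) ++ concat pss
    perm = ↭-trans (++⁺ʳ (concat pss) (↭-trans (prep y (shift x as bs)) (↭-trans (swap y x ↭-refl) (↭-arc as bs))))
       (↭-reflexive (cong (x ∷_) (++-assoc as (y ∷ bs) (concat pss))))
    u : Unique (x ∷ as ++ y ∷ bs ++ concat pss)
    u = gluing-unique g
    x∉ : x ∉ as ++ y ∷ bs ++ concat pss
    x∉ = head∉ u
    parts = unique-++⁻ as (tail-unique u)
    y∉ : y ∉ bs ++ concat pss
    y∉ = head∉ (proj₁ (proj₂ parts))
    new : All (IsCycle (reroute τ x y)) ((y ∷ as ++ x ∷ bs) ∷ pss)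
    new with cycles g
    ... | c ∷ d ∷ cs =
      path-++⁺ as
        (reroute-path τ x y as (x∉ ∘ ∈-++⁺ˡ) (λ y∈ → proj₂ (proj₂ parts) y∈ (here refl)) (reroute-y τ x y) c)
        (reroute-path τ x y bs (x∉ ∘ ∈-++⁺ʳ as ∘ there ∘ ∈-++⁺ˡ) (y∉ ∘ ∈-++⁺ˡ) (reroute-x τ x y) d)
      ∷ reroute-cycles τ x y pss (x∉ ∘ ∈-++⁺ʳ as ∘ there ∘ ∈-++⁺ʳ bs) (y∉ ∘ ∈-++⁺ʳ bs) cs

AnnLive : Vec (Fin n) n → List (Fin n) → List (Fin n) → Set
AnnLive v ps qs = Ann v (live v ps) (live v qs)

AnnLive-agree : (v w : Vec (Fin n) n) → ∀ ps qs → (∀ {z} → z ∈ ps ++ qs → v ! z ≡ w ! z) →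
  AnnLive v ps qs → AnnLive w ps qs
AnnLive-agree v w ps qs eq p = subst₂ (Ann w) (live-agree v w ps (eq ∘ ∈-++⁺ˡ)) (live-agree v w qs (eq ∘ ∈-++⁺ʳ ps))
  (Ann-cong (λ z∈ → eq (case ∈-++⁻ (live v ps) z∈ of λ where
    (inj₁ q) → ∈-++⁺ˡ {xs = ps} (∈-live⁻ v {ps = ps} q)
    (inj₂ q) → ∈-++⁺ʳ ps (∈-live⁻ v {ps = qs} q))) p)

module _ (v : Vec (Fin n) n) where

  NCLive-closed : ∀ {z} ps → NCLive v ps → z ∈ ps → v ! z ≢ z → v ! z ∈ ps
  NCLive-closed ps p z∈ z-live = ∈-live⁻ v (NC-closed p (∈-live⁺ v z∈ z-live))

  module _ {x : Fin n} (yx : v ! (v ! x) ≡ x) (x-live : v ! x ≢ x) where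
    private y = v ! x

    live-arc : ∀ as bs → live v (x ∷ as ++ y ∷ bs) ≡ x ∷ live v as ++ y ∷ live v bs
    live-arc as bs = trans (live-alive v x-live) (cong (x ∷_) (trans (live-++ v as (y ∷ bs))
      (cong (live v as ++_) (live-alive v (λ e → x-live (sym (trans (sym yx) e)))))))

    private
      unique-arc : ∀ as bs → Unique (x ∷ as ++ y ∷ bs) → Unique (x ∷ live v as ++ y ∷ live v bs)
      unique-arc as bs u = subst Unique (live-arc as bs) (live-unique v u)

    NCLive-arc⁺ : ∀ as bs → NCLive v as → NCLive v bs → NCLive v (x ∷ as ++ y ∷ bs)
    NCLive-arc⁺ as bs p q = subst (NC v) (sym (live-arc as bs)) (arc refl yx p q)

    NCLive-arc⁻ : ∀ as bs → Unique (x ∷ as ++ y ∷ bs) → NCLive v (x ∷ as ++ y ∷ bs) →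
      NCLive v as × NCLive v bs
    NCLive-arc⁻ as bs u p =
      proj₂ (NC-arc⁻ (tail-unique (unique-arc as bs u)) refl (subst (NC v) (live-arc as bs) p))

    AnnLive-left : ∀ as bs qs → NCLive v as → AnnLive v bs qs → AnnLive v (x ∷ as ++ y ∷ bs) qs
    AnnLive-left as bs qs p q = subst (λ l → Ann v l (live v qs)) (sym (live-arc as bs)) (left refl yx p q)

    AnnLive-right : ∀ as bs qs → AnnLive v as qs → NCLive v bs → AnnLive v (x ∷ as ++ y ∷ bs) qs
    AnnLive-right as bs qs p q = subst (λ l → Ann v l (live v qs)) (sym (live-arc as bs)) (right refl yx p q)

    AnnLive-arc⁻ : ∀ as bs qs → Unique ((x ∷ as ++ y ∷ bs) ++ qs) → AnnLive v (x ∷ as ++ y ∷ bs) qs →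
      NCLive v as × AnnLive v bs qs ⊎ AnnLive v as qs × NCLive v bs
    AnnLive-arc⁻ as bs qs u p = proj₂ (Ann-arc⁻ u′ refl (subst (λ l → Ann v l (live v qs)) (live-arc as bs) p))
      where
      u′ : Unique ((x ∷ live v as ++ y ∷ live v bs) ++ live v qs)
      u′ = subst Unique (trans (live-++ v (x ∷ as ++ y ∷ bs) qs) (cong (_++ live v qs) (live-arc as bs)))
             (live-unique v u)

    module _ (as bs cs : List (Fin n)) where
      private
        live-p : live v (x ∷ as) ≡ x ∷ live v as
        live-p = live-alive v x-live
        live-q : live v (cs ++ y ∷ bs) ≡ live v cs ++ y ∷ live v bs
        live-q = trans (live-++ v cs (y ∷ bs))
          (cong (live v cs ++_) (live-alive v (λ e → x-live (sym (trans (sym yx) e)))))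
        live-m : live v (as ++ bs ++ cs) ≡ live v as ++ live v bs ++ live v cs
        live-m = trans (live-++ v as (bs ++ cs)) (cong (live v as ++_) (live-++ v bs cs))

      AnnLive-bridge⁺ : NCLive v (as ++ bs ++ cs) → AnnLive v (x ∷ as) (cs ++ y ∷ bs)
      AnnLive-bridge⁺ p = subst₂ (Ann v) (sym live-p) (sym live-q)
        (bridge {cs = live v cs} refl yx (subst (NC v) live-m p))

      AnnLive-bridge⁻ : Unique ((x ∷ as) ++ cs ++ y ∷ bs) → AnnLive v (x ∷ as) (cs ++ y ∷ bs) →
        NCLive v (as ++ bs ++ cs)
      AnnLive-bridge⁻ u p = subst (NC v) (sym live-m)
        (proj₂ (Ann-bridge⁻ u′ refl (subst₂ (Ann v) live-p live-q p)))
        where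
        u′ : Unique ((x ∷ live v as) ++ live v cs ++ y ∷ live v bs)
        u′ = subst Unique (trans (live-++ v (x ∷ as) (cs ++ y ∷ bs)) (cong₂ _++_ live-p live-q))
               (live-unique v u)

module _ (v : Vec (Fin n) n) {x : Fin n} (x-live : v ! x ≢ x) where
  private
    y = v ! x
    x≢y = x-live ∘ sym
    v′ = kill v x y

  -- Deletion alters `v` only at `x` and `y`, so a statement about letters other than these can be
  -- carried over in both directions.
  revive : ∀ ps → x ∉ ps → y ∉ ps → NCLive v′ ps → NCLive v ps
  revive ps x∉ y∉ = NCLive-agree v′ v ps (λ z∈ → sym (kill-agree v x≢y x∉ y∉ z∈))

  deaden : ∀ ps → x ∉ ps → y ∉ ps → NCLive v ps → NCLive v′ ps
  deaden ps x∉ y∉ = NCLive-agree v v′ ps (kill-agree v x≢y x∉ y∉)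

  revive-all : ∀ pss → x ∉ concat pss → y ∉ concat pss → All (NCLive v′) pss → All (NCLive v) pss
  revive-all pss x∉ y∉ = NCLive-agree-all v′ v pss (λ z∈ → sym (kill-agree v x≢y x∉ y∉ z∈))

  deaden-all : ∀ pss → x ∉ concat pss → y ∉ concat pss → All (NCLive v) pss → All (NCLive v′) pss
  deaden-all pss x∉ y∉ = NCLive-agree-all v v′ pss (kill-agree v x≢y x∉ y∉)

  revive-ann : ∀ ps qs → x ∉ ps ++ qs → y ∉ ps ++ qs → AnnLive v′ ps qs → AnnLive v ps qs
  revive-ann ps qs x∉ y∉ = AnnLive-agree v′ v ps qs (λ z∈ → sym (kill-agree v x≢y x∉ y∉ z∈))

  deaden-ann : ∀ ps qs → x ∉ ps ++ qs → y ∉ ps ++ qs → AnnLive v ps qs → AnnLive v′ ps qs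
  deaden-ann ps qs x∉ y∉ = AnnLive-agree v v′ ps qs (kill-agree v x≢y x∉ y∉)

  live-x : ∀ ps → live v′ (x ∷ ps) ≡ live v′ ps
  live-x ps = live-dead v′ (kill-x v x≢y)

  live-y : ∀ ps → live v′ (y ∷ ps) ≡ live v′ ps
  live-y ps = live-dead v′ (kill-y v x≢y)

-- Vertex counts of noncrossing and annular gluings

Extremal : (Fin n → Fin n) → Vec (Fin n) n → List (List (Fin n)) → ℕ → Set
Extremal σ v pss N = numCycles σ ≤ length pss + N
  × (numCycles σ ≡ length pss + N → All (NCLive v) pss)
  × (All (NCLive v) pss → numCycles σ ≡ length pss + N)

no-edges : (v : Vec (Fin n) n) → length (live v (allFin n)) ≡ 0 → ∀ z → v ! z ≡ z
no-edges v eq z with v ! z ≟ z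
... | yes dead = dead
... | no alive with live v (allFin _) | ∈-live⁺ v {ps = allFin _} (∈-allFin z) alive
... | [] | ()

live-letter : (v : Vec (Fin n) n) → ∀ {m} → length (live v (allFin n)) ≡ suc m → ∃ λ z → v ! z ≢ z
live-letter v eq with live v (allFin _) in e
... | z ∷ _ = z , proj₂ (∈-filter⁻ (live? v) {xs = allFin _} (subst (z ∈_) (sym e) (here refl)))

cycle-cong : ∀ {τ τ′ : Fin n → Fin n} {ps} → (∀ z → τ z ≡ τ′ z) → IsCycle τ ps → IsCycle τ′ ps
cycle-cong {ps = x ∷ xs} eq = path-reroute xs (eq x) (λ {z} _ → eq z)

module _ {σ : Fin n → Fin n} where

  numCycles-no-edges : ∀ {v τ pss} → Gluing σ v τ pss 0 → numCycles σ ≡ length pss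
  numCycles-no-edges {v} {τ} {pss} g = numCycles-cycles σ pss
    (All.map (λ {ps} → cycle-cong {ps = ps} λ z → trans (cong τ (sym (no-edges v (edges g) z))) (factor g z)) (cycles g)) (covers g)

  module _ {v : Vec (Fin n) n} {τ : Fin n → Fin n} {x N} (x-live : v ! x ≢ x)
           (ih : ∀ {v τ pss} → Gluing σ v τ pss N → Extremal σ v pss N) where
    private
      y = v ! x
      v′ = kill v x y

    module _ {as bs pss} (g : Gluing σ v τ ((x ∷ as ++ y ∷ bs) ∷ pss) (suc N)) where
      private
        u : Unique (x ∷ y ∷ as ++ bs ++ concat pss)
        u = unique-resp-↭ (↭-sym (↭-left as bs (concat pss))) (gluing-unique g)
        x∉ : x ∉ as ++ bs ++ concat pss
        x∉ = head∉ u ∘ there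
        y∉ : y ∉ as ++ bs ++ concat pss
        y∉ = head∉ (tail-unique u)

      -- A split trades an edge for a polygon. The bound `K + N` stays the same, so equality before
      -- and after the deletion are equivalent, as are the noncrossing conditions.
      extremal-split : Extremal σ v ((x ∷ as ++ y ∷ bs) ∷ pss) (suc N)
      extremal-split with ih (gluing-split x-live g)
      ... | bound , to , from = subst (numCycles σ ≤_) eq bound , to′ , from′
        where
        eq : suc (suc (length pss)) + N ≡ suc (length pss) + suc N
        eq = sym (+-suc (suc (length pss)) N)
        to′ : numCycles σ ≡ suc (length pss) + suc N → All (NCLive v) ((x ∷ as ++ y ∷ bs) ∷ pss)
        to′ e with to (trans e (sym eq))
        ... | p ∷ q ∷ r =
          NCLive-arc⁺ v (involutive g x) x-live as bs
            (revive v x-live as (x∉ ∘ ∈-++⁺ˡ) (y∉ ∘ ∈-++⁺ˡ) (subst (NC v′) (live-y v x-live as) p))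
            (revive v x-live bs (x∉ ∘ ∈-++⁺ʳ as ∘ ∈-++⁺ˡ) (y∉ ∘ ∈-++⁺ʳ as ∘ ∈-++⁺ˡ) (subst (NC v′) (live-x v x-live bs) q))
          ∷ revive-all v x-live pss (x∉ ∘ ∈-++⁺ʳ as ∘ ∈-++⁺ʳ bs) (y∉ ∘ ∈-++⁺ʳ as ∘ ∈-++⁺ʳ bs) r
        from′ : All (NCLive v) ((x ∷ as ++ y ∷ bs) ∷ pss) → numCycles σ ≡ suc (length pss) + suc N
        from′ (p ∷ r) with NCLive-arc⁻ v (involutive g x) x-live as bs
                              (proj₁ (unique-++⁻ (x ∷ as ++ y ∷ bs) (gluing-unique g))) p
        ... | p₁ , p₂ = trans (from
          ( subst (NC v′) (sym (live-y v x-live as)) (deaden v x-live as (x∉ ∘ ∈-++⁺ˡ) (y∉ ∘ ∈-++⁺ˡ) p₁)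
          ∷ subst (NC v′) (sym (live-x v x-live bs)) (deaden v x-live bs (x∉ ∘ ∈-++⁺ʳ as ∘ ∈-++⁺ˡ) (y∉ ∘ ∈-++⁺ʳ as ∘ ∈-++⁺ˡ) p₂)
          ∷ deaden-all v x-live pss (x∉ ∘ ∈-++⁺ʳ as ∘ ∈-++⁺ʳ bs) (y∉ ∘ ∈-++⁺ʳ as ∘ ∈-++⁺ʳ bs) r)) eq

    -- A merge costs an edge and a polygon, so the inductive bound falls two short of `K + N` and
    -- equality is impossible. The noncrossing condition fails as well, since the edge at `x` leaves
    -- its polygon.
    extremal-merge : ∀ {as bs pss} → Gluing σ v τ ((x ∷ as) ∷ (y ∷ bs) ∷ pss) (suc N) →
      Extremal σ v ((x ∷ as) ∷ (y ∷ bs) ∷ pss) (suc N)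
    extremal-merge {as} {bs} {pss} g =
      ≤-trans (m≤n⇒m≤1+n (m≤n⇒m≤1+n small)) (≤-reflexive eq) ,
      (λ e → ⊥-elim (<-irrefl e (≤-trans (s≤s small) (≤-trans (n≤1+n _) (≤-reflexive eq))))) ,
      λ { (p ∷ _) → ⊥-elim (proj₂ (proj₂ (unique-++⁻ (x ∷ as) (gluing-unique g)))
            (NCLive-closed v (x ∷ as) p (here refl) x-live) (here refl)) }
      where
      small : numCycles σ ≤ suc (length pss) + N
      small = proj₁ (ih (gluing-merge x-live g))
      eq : suc (suc (suc (length pss) + N)) ≡ suc (suc (length pss)) + suc N
      eq = cong suc (sym (+-suc (suc (length pss)) N))

  extremal-resp : ∀ {v N pss qss} → length pss ≡ length qss →
    (All (NCLive v) pss → All (NCLive v) qss) → (All (NCLive v) qss → All (NCLive v) pss) →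
    Extremal σ v pss N → Extremal σ v qss N
  extremal-resp {N = N} eq f f⁻¹ (bound , to , from) =
    subst (λ k → numCycles σ ≤ k + N) eq bound ,
    (λ e → f (to (trans e (cong (_+ N) (sym eq))))) , λ p → trans (from (f⁻¹ p)) (cong (_+ N) eq)

  extremal-↭ : ∀ {v N pss qss} → pss ↭ qss → Extremal σ v pss N → Extremal σ v qss N
  extremal-↭ p = extremal-resp (↭-length p) (All-resp-↭ p) (All-resp-↭ (↭-sym p))

  extract : ∀ {v τ ps pss N y} → Gluing σ v τ (ps ∷ pss) N → y ∈ concat pss →
    ∃ λ cs → ∃₂ λ bs qss → pss ↭ (cs ++ y ∷ bs) ∷ qss × Gluing σ v τ (ps ∷ (y ∷ bs ++ cs) ∷ qss) N
  extract {ps = ps} {pss} g y∈ with ∈-concat⁻′ pss y∈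
  ... | qs , y∈qs , qs∈ with ∈⇒↭ qs∈ | ∈-∃++ y∈qs
  ... | qss , p | cs , bs , refl = cs , bs , qss , p ,
    gluing-↭ (swap _ _ ↭-refl) (gluing-rotate cs (gluing-↭ (↭-trans (prep ps p) (swap _ _ ↭-refl)) g))

  extremal-step : ∀ {v τ x rs pss N} → v ! x ≢ x →
    (∀ {v τ pss} → Gluing σ v τ pss N → Extremal σ v pss N) →
    Gluing σ v τ ((x ∷ rs) ∷ pss) (suc N) → Extremal σ v ((x ∷ rs) ∷ pss) (suc N)
  extremal-step {v} {x = x} {rs} {pss} x-live ih g with ∈-++⁻ (x ∷ rs) (gluing-∈ (v ! x) g)
  ... | inj₁ (here y≡x) = ⊥-elim (x-live y≡x)
  ... | inj₁ (there y∈) with ∈-∃++ y∈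
  ... | as , bs , refl = extremal-split x-live ih g
  extremal-step {v} {x = x} {rs} {pss} x-live ih g | inj₂ y∈ with extract g y∈
  ... | cs , bs , qss , p , g′ = extremal-↭ (prep (x ∷ rs) (↭-sym p)) (refute (extremal-merge x-live ih g′))
    where
    -- The second polygon was rotated to begin with the partner of `x`. Undoing this is harmless: on
    -- both sides the first polygon is not closed under `v`, hence not noncrossing.
    refute : Extremal σ v ((x ∷ rs) ∷ (v ! x ∷ bs ++ cs) ∷ qss) _ → Extremal σ v ((x ∷ rs) ∷ (cs ++ v ! x ∷ bs) ∷ qss) _
    refute = extremal-resp refl
      (λ { (q ∷ _) → ⊥-elim (out q) }) (λ { (q ∷ _) → ⊥-elim (out q) })
      where
      out : ¬ NCLive v (x ∷ rs)
      out q = proj₂ (proj₂ (unique-++⁻ (x ∷ rs) (gluing-unique g)))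
        (NCLive-closed v (x ∷ rs) q (here refl) x-live) y∈

  extremal : ∀ N {v τ pss} → Gluing σ v τ pss N → Extremal σ v pss N
  extremal zero {v} {pss = pss} g = ≤-reflexive eq ,
    (λ _ → All.tabulate λ {ps} _ → subst (NC v) (sym (filter-none (live? v)
      (All.tabulate {xs = ps} λ {z} _ alive → alive (no-edges v (edges g) z)))) []) ,
    λ _ → eq
    where
    eq : numCycles σ ≡ length pss + 0
    eq = trans (numCycles-no-edges g) (sym (+-identityʳ (length pss)))
  extremal (suc N) {v} {τ} {pss} g with live-letter v (edges g)
  ... | z , z-live with ∈-concat⁻′ pss (gluing-∈ z g)
  ... | ps , z∈ps , ps∈ with ∈⇒↭ ps∈ | first-live v ps z∈ps z-live
  ... | qss , p | ds , x , xs , refl , dead , x-live = extremal-↭ (↭-sym p)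
    (extremal-resp refl
      (λ { (q ∷ r) → subst (NC v) (live-rotate v ds dead) q ∷ r })
      (λ { (q ∷ r) → subst (NC v) (sym (live-rotate v ds dead)) q ∷ r })
      (extremal-step x-live (extremal N) (gluing-rotate ds (gluing-↭ p g))))

-- With `ps` and `qs` there are `K = length pss + 2` polygons, so `length pss + N` is `K + N - 2`.
-- The list `pss` is there to receive the polygons that splits cut off.
Bridged : (Fin n → Fin n) → Vec (Fin n) n → (ps qs : List (Fin n)) → List (List (Fin n)) → ℕ → Set
Bridged σ v ps qs pss N =
    (numCycles σ ≡ length pss + N → AnnLive v ps qs × All (NCLive v) pss)
  × (AnnLive v ps qs × All (NCLive v) pss → numCycles σ ≡ length pss + N)

module _ {σ : Fin n → Fin n} where

  -- The edge at `z` stands for connectedness. If the edge at `x` returns to its own polygon, the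
  -- edge at `z` survives the split and the induction goes on with the half containing `z`. If it
  -- leads to `qs`, the single merge is spent and `extremal` takes over. If it leads to a third
  -- polygon, the merge is spent while the edge at `z` still joins two polygons.
  bridged-step : ∀ {v τ x rs qs pss N z} → v ! x ≢ x →
    (∀ {v τ ps qs pss z} → Gluing σ v τ (ps ∷ qs ∷ pss) N → z ∈ ps → v ! z ∈ qs → Bridged σ v ps qs pss N) →
    Gluing σ v τ ((x ∷ rs) ∷ qs ∷ pss) (suc N) → z ∈ x ∷ rs → v ! z ∈ qs →
    Bridged σ v (x ∷ rs) qs pss (suc N)
  bridged-step {v} {τ} {x} {rs} {qs} {pss} {N} {z} x-live ih g z∈ vz∈ =
    locate (∈-++⁻ (x ∷ rs) (gluing-∈ y g))
    where
    y = v ! x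
    v′ = kill v x y
    x≢y = x-live ∘ sym
    yx : v ! y ≡ x
    yx = involutive g x
    ps#qs : ∀ {w} → w ∈ x ∷ rs → w ∉ qs
    ps#qs w∈ w∈′ = proj₂ (proj₂ (unique-++⁻ (x ∷ rs) (gluing-unique g))) w∈ (∈-++⁺ˡ w∈′)
    eq : suc (length pss) + N ≡ length pss + suc N
    eq = sym (+-suc (length pss) N)

    module Same (as bs : List (Fin n)) (split : rs ≡ as ++ y ∷ bs) where
      g₁ : Gluing σ v τ ((x ∷ as ++ y ∷ bs) ∷ qs ∷ pss) (suc N)
      g₁ = subst (λ l → Gluing σ v τ ((x ∷ l) ∷ qs ∷ pss) (suc N)) split g
      y∈rs : y ∈ rs
      y∈rs = subst (y ∈_) (sym split) (∈-++⁺ʳ as (here refl))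
      z≢x : z ≢ x
      z≢x e = ps#qs (there y∈rs) (subst (λ w → v ! w ∈ qs) e vz∈)
      z≢y : z ≢ y
      z≢y e = ps#qs (here refl) (subst (_∈ qs) yx (subst (λ w → v ! w ∈ qs) e vz∈))
      v′z∈ : v′ ! z ∈ qs
      v′z∈ = subst (_∈ qs) (kill-rest v x≢y z≢x z≢y) vz∈
      u : Unique (x ∷ y ∷ as ++ bs ++ qs ++ concat pss)
      u = unique-resp-↭ (↭-sym (↭-left as bs _)) (gluing-unique g₁)
      x∉ : x ∉ as ++ bs ++ qs ++ concat pss
      x∉ = head∉ u ∘ there
      y∉ : y ∉ as ++ bs ++ qs ++ concat pss
      y∉ = head∉ (tail-unique u)
      module Off {w : Fin n} (w∉ : w ∉ as ++ bs ++ qs ++ concat pss) where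
        off-as : w ∉ as
        off-as = w∉ ∘ ∈-++⁺ˡ
        off-bs : w ∉ bs
        off-bs = w∉ ∘ ∈-++⁺ʳ as ∘ ∈-++⁺ˡ
        off-qs : w ∉ qs
        off-qs = w∉ ∘ ∈-++⁺ʳ as ∘ ∈-++⁺ʳ bs ∘ ∈-++⁺ˡ
        off-pss : w ∉ concat pss
        off-pss = w∉ ∘ ∈-++⁺ʳ as ∘ ∈-++⁺ʳ bs ∘ ∈-++⁺ʳ qs
        off-as-qs : w ∉ as ++ qs
        off-as-qs w∈ = case ∈-++⁻ as w∈ of λ { (inj₁ q) → off-as q ; (inj₂ q) → off-qs q }
        off-bs-qs : w ∉ bs ++ qs
        off-bs-qs w∈ = case ∈-++⁻ bs w∈ of λ { (inj₁ q) → off-bs q ; (inj₂ q) → off-qs q }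
      open Off
      uq : Unique ((x ∷ as ++ y ∷ bs) ++ qs)
      uq = proj₁ (unique-++⁻ ((x ∷ as ++ y ∷ bs) ++ qs)
        (subst Unique (sym (++-assoc (x ∷ as ++ y ∷ bs) qs (concat pss))) (gluing-unique g₁)))
      z-live : v ! z ≢ z
      z-live e = ps#qs z∈ (subst (_∈ qs) e vz∈)
      not-closed : ∀ {ts} → z ∈ ts → (∀ {w} → w ∈ ts → w ∈ x ∷ rs) → ¬ NCLive v ts
      not-closed z∈ts ts⊆ p = ps#qs (ts⊆ (NCLive-closed v _ p z∈ts z-live)) vz∈
      as⊆ : ∀ {w} → w ∈ as → w ∈ x ∷ rs
      as⊆ w∈ = there (subst (_ ∈_) (sym split) (∈-++⁺ˡ w∈))
      bs⊆ : ∀ {w} → w ∈ bs → w ∈ x ∷ rs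
      bs⊆ w∈ = there (subst (_ ∈_) (sym split) (∈-++⁺ʳ as (there w∈)))

      live-y-qs : ∀ ts → Ann v′ (live v′ (y ∷ ts)) (live v′ qs) ≡ AnnLive v′ ts qs
      live-y-qs ts = cong (λ l → Ann v′ l (live v′ qs)) (live-y v x-live ts)
      live-x-qs : ∀ ts → Ann v′ (live v′ (x ∷ ts)) (live v′ qs) ≡ AnnLive v′ ts qs
      live-x-qs ts = cong (λ l → Ann v′ l (live v′ qs)) (live-x v x-live ts)

      -- The half with `as` is still joined to `qs` by the edge at `z`, so it stays in front; the
      -- half with `bs` goes to the other polygons and has to be noncrossing by itself.
      in-as : z ∈ as → Bridged σ v (x ∷ as ++ y ∷ bs) qs pss (suc N)
      in-as z∈as with ih (gluing-↭ (prep _ (swap _ _ ↭-refl)) (gluing-split x-live g₁)) (there z∈as) v′z∈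
      ... | to , from = to′ , from′
        where
        to′ : numCycles σ ≡ length pss + suc N → AnnLive v (x ∷ as ++ y ∷ bs) qs × All (NCLive v) pss
        to′ e with to (trans e (sym eq))
        ... | p , q ∷ r =
          AnnLive-right v yx x-live as bs qs
            (revive-ann v x-live as qs (off-as-qs x∉) (off-as-qs y∉) (subst (λ T → T) (live-y-qs as) p))
            (revive v x-live bs (off-bs x∉) (off-bs y∉) (subst (NC v′) (live-x v x-live bs) q)) ,
          revive-all v x-live pss (off-pss x∉) (off-pss y∉) r
        from′ : AnnLive v (x ∷ as ++ y ∷ bs) qs × All (NCLive v) pss → numCycles σ ≡ length pss + suc N
        from′ (p , r) with AnnLive-arc⁻ v yx x-live as bs qs uq p
        -- A noncrossing `as` would be closed, but the edge at `z` leads from it to `qs`.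
        ... | inj₁ (p₁ , _)  = ⊥-elim (not-closed z∈as as⊆ p₁)
        ... | inj₂ (p₁ , p₂) = trans (from
          ( subst (λ T → T) (sym (live-y-qs as)) (deaden-ann v x-live as qs (off-as-qs x∉) (off-as-qs y∉) p₁)
          , subst (NC v′) (sym (live-x v x-live bs)) (deaden v x-live bs (off-bs x∉) (off-bs y∉) p₂)
          ∷ deaden-all v x-live pss (off-pss x∉) (off-pss y∉) r)) eq

      in-bs : z ∈ bs → Bridged σ v (x ∷ as ++ y ∷ bs) qs pss (suc N)
      in-bs z∈bs with ih (gluing-↭ (↭-trans (swap _ _ ↭-refl) (prep _ (swap _ _ ↭-refl))) (gluing-split x-live g₁)) (there z∈bs) v′z∈
      ... | to , from = to′ , from′
        where
        to′ : numCycles σ ≡ length pss + suc N → AnnLive v (x ∷ as ++ y ∷ bs) qs × All (NCLive v) pss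
        to′ e with to (trans e (sym eq))
        ... | p , q ∷ r =
          AnnLive-left v yx x-live as bs qs
            (revive v x-live as (off-as x∉) (off-as y∉) (subst (NC v′) (live-y v x-live as) q))
            (revive-ann v x-live bs qs (off-bs-qs x∉) (off-bs-qs y∉) (subst (λ T → T) (live-x-qs bs) p)) ,
          revive-all v x-live pss (off-pss x∉) (off-pss y∉) r
        from′ : AnnLive v (x ∷ as ++ y ∷ bs) qs × All (NCLive v) pss → numCycles σ ≡ length pss + suc N
        from′ (p , r) with AnnLive-arc⁻ v yx x-live as bs qs uq p
        ... | inj₂ (_ , p₂)  = ⊥-elim (not-closed z∈bs bs⊆ p₂)
        ... | inj₁ (p₁ , p₂) = trans (from
          ( subst (λ T → T) (sym (live-x-qs bs)) (deaden-ann v x-live bs qs (off-bs-qs x∉) (off-bs-qs y∉) p₂)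
          , subst (NC v′) (sym (live-y v x-live as)) (deaden v x-live as (off-as x∉) (off-as y∉) p₁)
          ∷ deaden-all v x-live pss (off-pss x∉) (off-pss y∉) r)) eq

      result : Bridged σ v (x ∷ rs) qs pss (suc N)
      result = subst (λ l → Bridged σ v (x ∷ l) qs pss (suc N)) (sym split)
        (case ∈-arc⁻ as (subst (λ l → z ∈ x ∷ l) split z∈) of λ where
          (inj₁ e)               → ⊥-elim (z≢x e)
          (inj₂ (inj₁ e))        → ⊥-elim (z≢y e)
          (inj₂ (inj₂ (inj₁ q))) → in-as q
          (inj₂ (inj₂ (inj₂ q))) → in-bs q)

    module Across (cs bs : List (Fin n)) (split : qs ≡ cs ++ y ∷ bs) where
      g₀ : Gluing σ v τ ((x ∷ rs) ∷ (cs ++ y ∷ bs) ∷ pss) (suc N)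
      g₀ = subst (λ l → Gluing σ v τ ((x ∷ rs) ∷ l ∷ pss) (suc N)) split g
      g₁ : Gluing σ v τ ((x ∷ rs) ∷ (y ∷ bs ++ cs) ∷ pss) (suc N)
      g₁ = gluing-↭ (swap _ _ ↭-refl) (gluing-rotate cs (gluing-↭ (swap _ _ ↭-refl) g₀))
      u₁ : Unique (x ∷ rs ++ (y ∷ bs ++ cs) ++ concat pss)
      u₁ = gluing-unique g₁
      parts = unique-++⁻ rs (tail-unique u₁)
      x∉rs : x ∉ rs
      x∉rs = head∉ u₁ ∘ ∈-++⁺ˡ
      y∉rs : y ∉ rs
      y∉rs y∈ = proj₂ (proj₂ parts) y∈ (here refl)
      x∉bc : x ∉ bs ++ cs
      x∉bc = head∉ u₁ ∘ ∈-++⁺ʳ rs ∘ there ∘ ∈-++⁺ˡ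
      y∉bc : y ∉ bs ++ cs
      y∉bc = head∉ (proj₁ (proj₂ parts)) ∘ ∈-++⁺ˡ
      x∉pss : x ∉ concat pss
      x∉pss = head∉ u₁ ∘ ∈-++⁺ʳ rs ∘ ∈-++⁺ʳ (y ∷ bs ++ cs)
      y∉pss : y ∉ concat pss
      y∉pss = head∉ (proj₁ (proj₂ parts)) ∘ ∈-++⁺ʳ (bs ++ cs)
      x∉m : x ∉ rs ++ bs ++ cs
      x∉m x∈ = case ∈-++⁻ rs x∈ of λ { (inj₁ q) → x∉rs q ; (inj₂ q) → x∉bc q }
      y∉m : y ∉ rs ++ bs ++ cs
      y∉m y∈ = case ∈-++⁻ rs y∈ of λ { (inj₁ q) → y∉rs q ; (inj₂ q) → y∉bc q }
      uq : Unique ((x ∷ rs) ++ cs ++ y ∷ bs)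
      uq = proj₁ (unique-++⁻ ((x ∷ rs) ++ cs ++ y ∷ bs)
        (subst Unique (sym (++-assoc (x ∷ rs) (cs ++ y ∷ bs) (concat pss))) (gluing-unique g₀)))
      live-merged : live v′ (y ∷ rs ++ x ∷ bs ++ cs) ≡ live v′ (rs ++ bs ++ cs)
      live-merged = trans (live-y v x-live (rs ++ x ∷ bs ++ cs)) (trans (live-++ v′ rs (x ∷ bs ++ cs))
        (trans (cong (live v′ rs ++_) (live-x v x-live (bs ++ cs))) (sym (live-++ v′ rs (bs ++ cs)))))
      result : Bridged σ v (x ∷ rs) qs pss (suc N)
      -- After this merge `suc (length pss) + N` is the maximum for the remaining polygons, so they
      -- must all be noncrossing; for the merged one this is the premise of `bridge`.
      result with extremal N (gluing-merge x-live g₁)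
      ... | _ , to , from = subst (λ l → Bridged σ v (x ∷ rs) l pss (suc N)) (sym split) (to′ , from′)
        where
        to′ : numCycles σ ≡ length pss + suc N → AnnLive v (x ∷ rs) (cs ++ y ∷ bs) × All (NCLive v) pss
        to′ e with to (trans e (sym eq))
        ... | p ∷ r =
          AnnLive-bridge⁺ v yx x-live rs bs cs
            (revive v x-live (rs ++ bs ++ cs) x∉m y∉m (subst (NC v′) live-merged p)) ,
          revive-all v x-live pss x∉pss y∉pss r
        from′ : AnnLive v (x ∷ rs) (cs ++ y ∷ bs) × All (NCLive v) pss → numCycles σ ≡ length pss + suc N
        from′ (p , r) = trans (from
          ( subst (NC v′) (sym live-merged)
              (deaden v x-live (rs ++ bs ++ cs) x∉m y∉m (AnnLive-bridge⁻ v yx x-live rs bs cs uq p))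
          ∷ deaden-all v x-live pss x∉pss y∉pss r)) eq

    -- Here the edge joins the first polygon to a third one, so merging leaves a face
    -- that is still joined to qs and hence is not closed under v.
    module Outside (y∈ : y ∈ concat pss) where
      y∉qs : y ∉ qs
      y∉qs y∈qs = proj₂ (proj₂ (unique-++⁻ qs (proj₁ (proj₂ (unique-++⁻ (x ∷ rs) (gluing-unique g)))))) y∈qs y∈
      y∉ps : y ∉ x ∷ rs
      y∉ps y∈ps = proj₂ (proj₂ (unique-++⁻ (x ∷ rs) (gluing-unique g))) y∈ps (∈-++⁺ʳ qs y∈)
      z-live : v ! z ≢ z
      z-live e = ps#qs z∈ (subst (_∈ qs) e vz∈)
      refute : ¬ AnnLive v (x ∷ rs) qs
      refute p = case ∈-++⁻ (live v (x ∷ rs)) (Ann-closed p (∈-++⁺ˡ (∈-live⁺ v {ps = x ∷ rs} (here refl) x-live))) of λ where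
        (inj₁ q) → y∉ps (∈-live⁻ v {ps = x ∷ rs} q)
        (inj₂ q) → y∉qs (∈-live⁻ v {ps = qs} q)
      z≢x : z ≢ x
      z≢x e = y∉qs (subst (λ w → v ! w ∈ qs) e vz∈)
      z≢y : z ≢ y
      z≢y e = y∉ps (subst (_∈ x ∷ rs) e z∈)
      z∈rs : z ∈ rs
      z∈rs = case z∈ of λ { (here e) → ⊥-elim (z≢x e) ; (there q) → q }
      impossible : numCycles σ ≢ length pss + suc N
      impossible e with ∈-concat⁻′ pss y∈
      ... | ts , y∈ts , ts∈ with ∈⇒↭ ts∈ | ∈-∃++ y∈ts
      ... | qss , p | cs , bs , refl = contradict
        where
        g₁ : Gluing σ v τ ((x ∷ rs) ∷ (y ∷ bs ++ cs) ∷ qs ∷ qss) (suc N)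
        g₁ = gluing-↭ (swap _ _ ↭-refl) (gluing-rotate cs (gluing-↭
          (↭-trans (prep _ (↭-trans (prep qs p) (swap _ _ ↭-refl))) (swap _ _ ↭-refl)) g))
        merged = y ∷ rs ++ x ∷ bs ++ cs
        g₂ : Gluing σ v′ (reroute τ x y) (merged ∷ qs ∷ qss) N
        g₂ = gluing-merge x-live g₁
        merged#qs : ∀ {w} → w ∈ merged → w ∉ qs
        merged#qs w∈ w∈′ = proj₂ (proj₂ (unique-++⁻ merged (gluing-unique g₂))) w∈ (∈-++⁺ˡ w∈′)
        contradict : ⊥
        -- The count in `e` is the maximum for the polygons left after the merge, so the merged
        -- polygon would be noncrossing and hence closed.
        contradict with proj₁ (proj₂ (extremal N g₂)) (trans e
          (trans (cong (_+ suc N) (↭-length p)) (cong suc (+-suc (length qss) N))))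
        ... | q ∷ _ = merged#qs
          (NCLive-closed v′ merged q (there (∈-++⁺ˡ z∈rs)) (λ e′ → z-live (trans (kill-rest v x≢y z≢x z≢y) e′)))
          (subst (_∈ qs) (kill-rest v x≢y z≢x z≢y) vz∈)
      result : Bridged σ v (x ∷ rs) qs pss (suc N)
      result = (λ e → ⊥-elim (impossible e)) , λ (p , _) → ⊥-elim (refute p)

    locate : y ∈ x ∷ rs ⊎ y ∈ qs ++ concat pss → Bridged σ v (x ∷ rs) qs pss (suc N)
    locate (inj₁ (here e)) = ⊥-elim (x-live e)
    locate (inj₁ (there y∈)) with ∈-∃++ y∈
    ... | as , bs , split = Same.result as bs split
    locate (inj₂ y∈) with ∈-++⁻ qs y∈
    ... | inj₂ y∈pss = Outside.result y∈pss
    ... | inj₁ y∈qs with ∈-∃++ y∈qs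
    ... | cs , bs , split = Across.result cs bs split

  bridged : ∀ N {v τ ps qs pss z} → Gluing σ v τ (ps ∷ qs ∷ pss) N → z ∈ ps → v ! z ∈ qs →
    Bridged σ v ps qs pss N
  bridged N {v} {τ} {ps} {qs} {pss} {z} g z∈ vz∈ with first-live v ps z∈ z-live
    where
    z-live : v ! z ≢ z
    z-live e = proj₂ (proj₂ (unique-++⁻ ps (gluing-unique g))) z∈ (∈-++⁺ˡ (subst (_∈ qs) e vz∈))
  bridged zero {v} g z∈ vz∈ | _ , x , _ , _ , _ , x-live = ⊥-elim (x-live (no-edges v (edges g) x))
  bridged (suc N) {v} {qs = qs} {pss} g z∈ vz∈ | ds , x , xs , refl , dead , x-live
    with bridged-step x-live (bridged N) (gluing-rotate ds g) (∈-resp-↭ (++-comm ds (x ∷ xs)) z∈) vz∈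
  ... | to , from =
    (λ e → let p , r = to e in subst (λ l → Ann v l (live v qs)) (live-rotate v ds dead) p , r) ,
    (λ (p , r) → from (subst (λ l → Ann v l (live v qs)) (sym (live-rotate v ds dead)) p , r))

-- The polygons of a gluing datum

toFinOr-toℕ : (y d : Fin n) → toFinOr (toℕ y) d ≡ y
toFinOr-toℕ {n} y d with toℕ y <? n
... | yes p = toℕ-injective (toℕ-fromℕ< p)
... | no ¬p = ⊥-elim (¬p (toℕ<n y))

tau-value : (cs : List ℕ) (x y : Fin n) → tauℕ cs 0 (toℕ x) ≡ toℕ y → tau cs x ≡ y
tau-value cs x y eq = trans (cong (λ k → toFinOr k x) eq) (toFinOr-toℕ y x)

module _ (m : ℕ) (ms : List ℕ) (s : ℕ) {x : ℕ} where

  tauℕ-next : suc x < s + m → tauℕ (m ∷ ms) s x ≡ suc x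
  tauℕ-next p with x <? s + m | suc x <? s + m
  ... | yes _ | yes _ = refl
  ... | no ¬q | _     = ⊥-elim (¬q (≤-trans (n<1+n _) (≤-trans (n≤1+n _) p)))
  ... | yes _ | no ¬p = ⊥-elim (¬p p)

  tauℕ-last : suc x ≡ s + m → tauℕ (m ∷ ms) s x ≡ s
  tauℕ-last e with x <? s + m | suc x <? s + m
  ... | yes _ | yes p = ⊥-elim (<-irrefl e p)
  ... | no ¬q | _     = ⊥-elim (¬q (≤-reflexive e))
  ... | yes _ | no _  = refl

  tauℕ-later : s + m ≤ x → tauℕ (m ∷ ms) s x ≡ tauℕ ms (s + m) x
  tauℕ-later p with x <? s + m
  ... | yes q = ⊥-elim (<⇒≱ q p)
  ... | no _  = refl

path-tabulate : ∀ {τ : Fin n → Fin n} {m z} (f : Fin (suc m) → Fin n) →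
  (∀ i → τ (f (inject₁ i)) ≡ f (suc i)) → τ (f (fromℕ m)) ≡ z → Path τ (f zero) (tabulate (f ∘ suc)) z
path-tabulate {m = zero}  f next last = last
path-tabulate {m = suc m} f next last = next zero , path-tabulate (f ∘ suc) (next ∘ suc) last

tabulate-++ : ∀ {A : Set} m {k} (f : Fin (m + k) → A) →
  tabulate f ≡ tabulate (f ∘ (_↑ˡ k)) ++ tabulate (f ∘ (m ↑ʳ_))
tabulate-++ zero    f = refl
tabulate-++ (suc m) f = cong (f zero ∷_) (tabulate-++ m (f ∘ suc))

one-face : ∀ n → IsCycle (tau (suc n ∷ [])) (allFin (suc n))
one-face n = path-tabulate (λ i → i)
  (λ i → tau-value (suc n ∷ []) (inject₁ i) (suc i) (trans (cong (tauℕ (suc n ∷ []) 0) (toℕ-inject₁ i))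
    (tauℕ-next (suc n) [] 0 (s≤s (toℕ<n i)))))
  (tau-value (suc n ∷ []) (fromℕ n) zero (trans (cong (tauℕ (suc n ∷ []) 0) (toℕ-fromℕ n)) (tauℕ-last (suc n) [] 0 refl)))

-- Cutting `allFin n` makes sense for every `n`, in particular for `2 * N`, which is not
-- definitionally a sum of the two lengths. For `n` of the form `a + b` the pieces become
-- tabulations, on which `tau` can be computed.
face₁ face₂ : ℕ → (n : ℕ) → List (Fin n)
face₁ a n = take a (allFin n)
face₂ a n = drop a (allFin n)

faces-++ : ∀ a n → face₁ a n ++ face₂ a n ≡ allFin n
faces-++ a n = take++drop≡id a (allFin n)

take-length : {A : Set} (as : List A) {bs : List A} → take (length as) (as ++ bs) ≡ as
take-length []       = refl
take-length (a ∷ as) = cong (a ∷_) (take-length as)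

drop-length : {A : Set} (as : List A) {bs : List A} → drop (length as) (as ++ bs) ≡ bs
drop-length []       = refl
drop-length (a ∷ as) = drop-length as

face₁-tabulate : ∀ a b → face₁ a (a + b) ≡ tabulate (_↑ˡ b)
face₁-tabulate a b = trans (cong₂ take {x = a} (sym (length-tabulate (_↑ˡ b))) (tabulate-++ a (λ i → i)))
  (take-length (tabulate (_↑ˡ b)))

face₂-tabulate : ∀ a b → face₂ a (a + b) ≡ tabulate (a ↑ʳ_)
face₂-tabulate a b = trans (cong₂ drop {x = a} (sym (length-tabulate (_↑ˡ b))) (tabulate-++ a (λ i → i)))
  (drop-length (tabulate (_↑ˡ b)))

two-faces : ∀ a b → let n = suc a + suc b ; τ = tau {n} (suc a ∷ suc b ∷ []) in
  IsCycle τ (face₁ (suc a) n) × IsCycle τ (face₂ (suc a) n)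
two-faces a b =
  subst (IsCycle τ) (sym (face₁-tabulate (suc a) (suc b))) (path-tabulate {τ = τ} (_↑ˡ suc b)
    (λ i → value (inject₁ i ↑ˡ suc b) (suc i ↑ˡ suc b)
      (trans (toℕ-↑ˡ (inject₁ i) (suc b)) (toℕ-inject₁ i)) (toℕ-↑ˡ (suc i) (suc b))
      (tauℕ-next (suc a) (suc b ∷ []) 0 (s≤s (toℕ<n i))))
    (value (fromℕ a ↑ˡ suc b) zero (trans (toℕ-↑ˡ (fromℕ a) (suc b)) (toℕ-fromℕ a)) refl
      (tauℕ-last (suc a) (suc b ∷ []) 0 refl))) ,
  subst (IsCycle τ) (sym (face₂-tabulate (suc a) (suc b))) (path-tabulate {τ = τ} (suc a ↑ʳ_)
    (λ i → value (suc a ↑ʳ inject₁ i) (suc a ↑ʳ suc i)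
      (trans (toℕ-↑ʳ (suc a) (inject₁ i)) (cong (suc a +_) (toℕ-inject₁ i)))
      (trans (toℕ-↑ʳ (suc a) (suc i)) (+-suc (suc a) (toℕ i)))
      (trans (tauℕ-later (suc a) (suc b ∷ []) 0 (m≤m+n (suc a) (toℕ i)))
        (tauℕ-next (suc b) [] (suc a) (subst (_< suc a + suc b) (+-suc (suc a) (toℕ i))
          (+-monoʳ-< (suc a) (s≤s (toℕ<n i)))))))
    (value (suc a ↑ʳ fromℕ b) (suc a ↑ʳ zero)
      (trans (toℕ-↑ʳ (suc a) (fromℕ b)) (cong (suc a +_) (toℕ-fromℕ b)))
      (trans (toℕ-↑ʳ (suc a) zero) (+-identityʳ (suc a)))
      (trans (tauℕ-later (suc a) (suc b ∷ []) 0 (m≤m+n (suc a) b))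
        (tauℕ-last (suc b) [] (suc a) (sym (+-suc (suc a) b))))))
  where
  cs : List ℕ
  cs = suc a ∷ suc b ∷ []
  τ : Fin (suc a + suc b) → Fin (suc a + suc b)
  τ = tau cs
  value : ∀ x y {i j} → toℕ x ≡ i → toℕ y ≡ j → tauℕ cs 0 i ≡ j → τ x ≡ y
  value x y ex ey e = tau-value cs x y (trans (cong (tauℕ cs 0) ex) (trans e (sym ey)))

-- Connectedness and planarity for one and two polygons

module _ {ι τ : Fin n → Fin n} where

  reach-suc : ∀ {x y} k → y ∈ reach ι τ k x → y ∈ reach ι τ (suc k) x
  reach-suc k = ∈-++⁺ˡ

  reach-≤ : ∀ {x y j k} → j ≤ k → y ∈ reach ι τ j x → y ∈ reach ι τ k x
  reach-≤ j≤k = go (≤⇒≤′ j≤k)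
    where
    go : ∀ {x y j k} → j ≤′ k → y ∈ reach ι τ j x → y ∈ reach ι τ k x
    go ≤′-refl                = λ y∈ → y∈
    go (≤′-step {n = k} j≤k) = reach-suc k ∘ go j≤k

  reach-ι : ∀ {x y} k → y ∈ reach ι τ k x → ι y ∈ reach ι τ (suc k) x
  reach-ι {x} k y∈ = ∈-++⁺ʳ (reach ι τ k x) (∈-++⁺ˡ (∈-map⁺ ι y∈))

  reach-iter : ∀ {x y} j k → y ∈ reach ι τ k x → iter j τ y ∈ reach ι τ (j + k) x
  reach-iter zero    k y∈ = y∈
  reach-iter {x} (suc j) k y∈ =
    ∈-++⁺ʳ (reach ι τ (j + k) x) (∈-++⁺ʳ (map ι (reach ι τ (j + k) x)) (∈-map⁺ τ (reach-iter j k y∈)))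

  reach-closed : ∀ {ps x y} → (∀ {z} → z ∈ ps → ι z ∈ ps) → (∀ {z} → z ∈ ps → τ z ∈ ps) →
    x ∈ ps → ∀ k → y ∈ reach ι τ k x → y ∈ ps
  reach-closed ι∈ τ∈ x∈ zero    (here refl) = x∈
  reach-closed {x = x} ι∈ τ∈ x∈ (suc k) y∈ with ∈-++⁻ (reach ι τ k x) y∈
  ... | inj₁ q = reach-closed ι∈ τ∈ x∈ k q
  ... | inj₂ q with ∈-++⁻ (map ι (reach ι τ k x)) q
  ... | inj₁ r with ∈-map⁻ ι r
  ... | z , z∈ , refl = ι∈ (reach-closed ι∈ τ∈ x∈ k z∈)
  reach-closed {x = x} ι∈ τ∈ x∈ (suc k) y∈ | inj₂ q | inj₂ r with ∈-map⁻ τ r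
  ... | z , z∈ , refl = τ∈ (reach-closed ι∈ τ∈ x∈ k z∈)

  reach-cycle : ∀ {ps x y} → IsCycle τ ps → length ps ≤ n → x ∈ ps → y ∈ ps → y ∈ reach ι τ n x
  reach-cycle {x = x} c ps≤ x∈ y∈ with cycle-reaches c x∈ y∈
  ... | k , k< , refl = reach-≤ (≤-trans (≤-reflexive (+-identityʳ k)) (≤-trans (n≤1+n k) (≤-trans k< ps≤)))
    (reach-iter k 0 (here refl))

  -- Fewer than `length ps` steps lead to the crossing edge, one step crosses it, and fewer than
  -- `length qs` steps follow. The word thus has fewer than `n` letters, within the bound used in
  -- `Transitive`.
  reach-cross : ∀ {ps qs x y z} → IsCycle τ ps → IsCycle τ qs → length ps + length qs ≤ n →
    z ∈ ps → ι z ∈ qs → x ∈ ps → y ∈ qs → y ∈ reach ι τ n x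
  reach-cross {ps} {qs} {x} c d pq≤ z∈ ιz∈ x∈ y∈ with cycle-reaches c x∈ z∈
  ... | j , j< , refl with cycle-reaches d ιz∈ y∈
  ... | k , k< , refl = reach-≤ bound (reach-iter k (suc (j + 0)) (reach-ι (j + 0) (reach-iter j 0 (here refl))))
    where
    bound : k + suc (j + 0) ≤ n
    bound = ≤-trans (+-mono-≤ (≤-trans (n≤1+n k) k<) (subst (λ i → suc i ≤ length ps) (sym (+-identityʳ j)) j<))
      (≤-trans (≤-reflexive (+-comm (length qs) (length ps))) pq≤)

module _ {v : Vec (Fin n) n} where

  Paired : Fin n → Set
  Paired z = v ! (v ! z) ≡ z × v ! z ≢ z

  arc-paired : ∀ {x y} → v ! x ≡ y → v ! y ≡ x → x ≢ y → Paired x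
  arc-paired xy yx x≢y = trans (cong (v !_) xy) yx , λ e → x≢y (trans (sym e) xy)

  NC-paired : ∀ {ps z} → Unique ps → NC v ps → z ∈ ps → Paired z
  NC-paired u (arc {x} {y} {as} {bs} xy yx p q) z∈ with unique-resp-↭ (↭-sym (↭-arc as bs)) u | ∈-arc⁻ as z∈
  ... | (x≢y ∷ _) ∷ _ | inj₁ refl               = arc-paired xy yx x≢y
  ... | (x≢y ∷ _) ∷ _ | inj₂ (inj₁ refl)        = arc-paired yx xy (x≢y ∘ sym)
  ... | _ ∷ _ ∷ u′    | inj₂ (inj₂ (inj₁ z∈as)) = NC-paired (proj₁ (unique-++⁻ as u′)) p z∈as
  ... | _ ∷ _ ∷ u′    | inj₂ (inj₂ (inj₂ z∈bs)) = NC-paired (proj₁ (proj₂ (unique-++⁻ as u′))) q z∈bs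

  Ann-paired : ∀ {ps qs z} → Unique (ps ++ qs) → Ann v ps qs → z ∈ ps ++ qs → Paired z
  Ann-paired u (bridge {as = as} {bs} {cs} xy yx p) z∈
    with unique-resp-↭ (↭-sym (↭-bridge as bs cs)) u | ∈-resp-↭ (↭-sym (↭-bridge as bs cs)) z∈
  ... | (x≢y ∷ _) ∷ _ | here refl         = arc-paired xy yx x≢y
  ... | (x≢y ∷ _) ∷ _ | there (here refl) = arc-paired yx xy (x≢y ∘ sym)
  ... | _ ∷ _ ∷ u′    | there (there q)     = NC-paired u′ p q
  Ann-paired {qs = qs} u (left {as = as} {bs} xy yx p q) z∈
    with unique-resp-↭ (↭-sym (↭-left as bs qs)) u | ∈-resp-↭ (↭-sym (↭-left as bs qs)) z∈
  ... | (x≢y ∷ _) ∷ _ | here refl         = arc-paired xy yx x≢y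
  ... | (x≢y ∷ _) ∷ _ | there (here refl) = arc-paired yx xy (x≢y ∘ sym)
  ... | _ ∷ _ ∷ u′    | there (there r) with unique-++⁻ as u′ | ∈-++⁻ as r
  ... | u₁ , _        | inj₁ s = NC-paired u₁ p s
  ... | _ , u₂ , _    | inj₂ s = Ann-paired u₂ q s
  Ann-paired {qs = qs} u (right {as = as} {bs} xy yx p q) z∈
    with unique-resp-↭ (↭-sym (↭-right as bs qs)) u | ∈-resp-↭ (↭-sym (↭-right as bs qs)) z∈
  ... | (x≢y ∷ _) ∷ _ | here refl         = arc-paired xy yx x≢y
  ... | (x≢y ∷ _) ∷ _ | there (here refl) = arc-paired yx xy (x≢y ∘ sym)
  ... | _ ∷ _ ∷ u′    | there (there r) with unique-++⁻ (as ++ qs) u′ | ∈-++⁻ (as ++ qs) r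
  ... | u₁ , _        | inj₁ s = Ann-paired u₁ p s
  ... | _ , u₂ , _    | inj₂ s = NC-paired u₂ q s

module _ (v : Vec (Fin n) n) (ff : IsFFInvolution v) where

  live-all : ∀ ps → live v ps ≡ ps
  live-all ps = filter-all (live? v) (All.tabulate λ {z} _ → proj₂ (ff z))

  initial-gluing : ∀ {τ pss N} → n ≡ N + N → All (IsCycle τ) pss → concat pss ≡ allFin n →
    Gluing (λ x → τ (lookup v x)) v τ pss N
  initial-gluing eq cs covers = record
    { involutive = λ z → proj₁ (ff z)
    ; factor     = λ _ → refl
    ; edges      = trans (cong length (live-all (allFin n))) (trans (length-tabulate (λ z → z)) eq)
    ; cycles     = cs
    ; covers     = ↭-reflexive covers }

module _ {N : ℕ} {τ : Fin n → Fin n} (cycle : IsCycle τ (allFin n)) (eq : n ≡ N + N)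
         {v : Vec (Fin n) n} (ff : IsFFInvolution v) where
  private
    ext : Extremal (λ x → τ (lookup v x)) v (allFin n ∷ []) N
    ext = extremal N (initial-gluing v ff eq (cycle ∷ []) (++-identityʳ _))

  one-face-planar⁻ : numCycles (λ x → τ (lookup v x)) ≡ suc N → NC v (allFin n)
  one-face-planar⁻ e with proj₁ (proj₂ ext) e
  ... | p ∷ [] = subst (NC v) (live-all v ff (allFin n)) p

  one-face-planar⁺ : NC v (allFin n) → Transitive (lookup v) τ × numCycles (λ x → τ (lookup v x)) ≡ suc N
  one-face-planar⁺ p =
    -- With a single polygon `τ` alone is transitive.
    (λ x y → reach-cycle cycle (≤-reflexive (length-tabulate (λ z → z))) (∈-allFin x) (∈-allFin y)) ,
    proj₂ (proj₂ ext) (subst (NC v) (sym (live-all v ff (allFin n))) p ∷ [])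

two-faces-≡ : ∀ {a b n} → suc a + suc b ≡ n → let τ = tau {n} (suc a ∷ suc b ∷ []) in
  IsCycle τ (face₁ (suc a) n) × IsCycle τ (face₂ (suc a) n)
two-faces-≡ {a} {b} refl = two-faces a b

module _ {a N : ℕ} {τ : Fin n → Fin n} (two : IsCycle τ (face₁ a n) × IsCycle τ (face₂ a n))
         (eq : n ≡ N + N) {v : Vec (Fin n) n} (ff : IsFFInvolution v) where
  private
    ps = face₁ a n
    qs = face₂ a n

    g : Gluing (λ x → τ (lookup v x)) v τ (ps ∷ qs ∷ []) N
    g = initial-gluing v ff eq (proj₁ two ∷ proj₂ two ∷ [])
      (trans (cong (ps ++_) (++-identityʳ qs)) (faces-++ a n))

    locate : ∀ z → z ∈ ps ⊎ z ∈ qs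
    locate z = ∈-++⁻ ps (subst (z ∈_) (sym (faces-++ a n)) (∈-allFin z))

    ps#qs : ∀ {z} → z ∈ ps → z ∉ qs
    ps#qs z∈ z∈′ = proj₂ (proj₂ (unique-++⁻ ps (gluing-unique g))) z∈ (∈-++⁺ˡ z∈′)

    lengths : length ps + length qs ≡ n
    lengths = trans (sym (length-++ ps)) (trans (cong length (faces-++ a n)) (length-tabulate (λ z → z)))

    -- Without such an edge the first polygon would be closed under both `v` and `τ`, and no word
    -- could lead from it to the second.
    crossing : Transitive (lookup v) τ → ∃ λ z → z ∈ ps × v ! z ∈ qs
    crossing t with any? (λ z → v ! z ∈? qs) ps
      where open DecMembership (_≟_ {n}) using (_∈?_)
    ... | yes c = find c
    ... | no ¬c = ⊥-elim (ps#qs (reach-closed v-closed (cycle-closed (proj₁ two)) (proj₂ x) n (t _ _)) (proj₂ y))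
      where
      v-closed : ∀ {z} → z ∈ ps → v ! z ∈ ps
      v-closed {z} z∈ = case locate (v ! z) of λ { (inj₁ p) → p ; (inj₂ q) → ⊥-elim (¬c (lose z∈ q)) }
      member : ∀ {rs} → IsCycle τ rs → ∃ λ x → x ∈ rs
      member {x ∷ _} _ = x , here refl
      x = member (proj₁ two)
      y = member (proj₂ two)

    liveAnn : AnnLive v ps qs ≡ Ann v ps qs
    liveAnn = cong₂ (Ann v) (live-all v ff ps) (live-all v ff qs)

  two-face-planar⁻ : Transitive (lookup v) τ → numCycles (λ x → τ (lookup v x)) ≡ N → Ann v ps qs
  two-face-planar⁻ t e = let z , z∈ , vz∈ = crossing t in
    subst (λ T → T) liveAnn (proj₁ (proj₁ (bridged N g z∈ vz∈) e))

  two-face-planar⁺ : Ann v ps qs → Transitive (lookup v) τ × numCycles (λ x → τ (lookup v x)) ≡ N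
  two-face-planar⁺ p with Ann-crosses p
  ... | z , z∈ , vz∈ = transitive , proj₂ (bridged N g z∈ vz∈) (subst (λ T → T) (sym liveAnn) p , [])
    where
    transitive : Transitive (lookup v) τ
    transitive x y with locate x | locate y
    ... | inj₁ x∈ | inj₁ y∈ = reach-cycle (proj₁ two) (≤-trans (m≤m+n _ _) (≤-reflexive lengths)) x∈ y∈
    ... | inj₂ x∈ | inj₂ y∈ = reach-cycle (proj₂ two)
      (≤-trans (m≤m+n _ _) (≤-reflexive (trans (+-comm (length qs) (length ps)) lengths))) x∈ y∈
    ... | inj₁ x∈ | inj₂ y∈ = reach-cross (proj₁ two) (proj₂ two) (≤-reflexive lengths) z∈ vz∈ x∈ y∈
    ... | inj₂ x∈ | inj₁ y∈ = reach-cross (proj₂ two) (proj₁ two)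
      (≤-reflexive (trans (+-comm (length qs) (length ps)) lengths)) vz∈ (subst (_∈ ps) (sym (proj₁ (ff z))) z∈) x∈ y∈

-- Enumeration of gluing data

card-conv : {S : ℕ → B → Set} (k : ℕ → ℕ → ℕ) (p : ℕ) →
  (∀ {a a′ b} → S a b → S a′ b → a ≡ a′) →
  (∀ a b → a + suc b ≡ p → Card (S a) (k a b)) →
  Card (λ b → ∃ λ a → a < p × S a b) (conv k p)
card-conv k zero    disjoint c = card-⊥ λ { (_ , () , _) }
card-conv {S = S} k (suc p) disjoint c = card-⇔
  (λ { (inj₁ s) → 0 , s≤s z≤n , s ; (inj₂ (a , a< , s)) → suc a , s≤s a< , s })
  (λ { (zero , _ , s) → inj₁ s ; (suc a , s≤s a< , s) → inj₂ (a , a< , s) })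
  (card-⊎ (λ { s (a , _ , s′) → case disjoint s s′ of λ () })
    (c 0 p refl)
    (card-conv (λ a → k (suc a)) p (λ s s′ → suc-injective (disjoint s s′)) (λ a b eq → c (suc a) b (cong suc eq))))

∈-concatMap⁻′ : (f : A → List B) (xs : List A) {y : B} → y ∈ concatMap f xs → ∃ λ x → x ∈ xs × y ∈ f x
∈-concatMap⁻′ f xs y∈ with ∈-concat⁻′ (map f xs) y∈
... | ys , y∈ys , ys∈ with ∈-map⁻ f ys∈
... | x , x∈ , refl = x , x∈ , y∈ys

∈-concatMap⁺′ : (f : A → List B) {xs : List A} {x : A} {y : B} → x ∈ xs → y ∈ f x → y ∈ concatMap f xs
∈-concatMap⁺′ f x∈ y∈ = ∈-concat⁺′ y∈ (∈-map⁺ f x∈)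

concatMap-unique : (f : A → List B) {xs : List A} → Unique xs → (∀ x → Unique (f x)) →
  (∀ {x x′ y} → y ∈ f x → y ∈ f x′ → x ≡ x′) → Unique (concatMap f xs)
concatMap-unique f []       uf disjoint = []
concatMap-unique f {x ∷ xs} (p ∷ u) uf disjoint = Unique.++⁺ (uf x) (concatMap-unique f u uf disjoint)
  λ (y∈ , y∈′) → let x′ , x′∈ , y∈fx′ = ∈-concatMap⁻′ f xs y∈′ in All.lookup p x′∈ (disjoint y∈ y∈fx′)

compositions-suc : ∀ n K → compositions n (suc K) ≡
  concatMap (λ m → map (suc m ∷_) (compositions (n ∸ suc m) K)) (upTo n)
compositions-suc zero    K = refl
compositions-suc (suc n) K = refl

compositions-unique : ∀ n K → Unique (compositions n K)
compositions-unique zero    zero    = [] ∷ []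
compositions-unique (suc n) zero    = []
compositions-unique n       (suc K) = subst Unique (sym (compositions-suc n K))
  (concatMap-unique _ (Unique.upTo⁺ n) (λ m → Unique.map⁺ ∷-injectiveʳ (compositions-unique (n ∸ suc m) K))
    λ y∈ y∈′ → let _ , _ , eq = ∈-map⁻ _ y∈ ; _ , _ , eq′ = ∈-map⁻ _ y∈′ in
      suc-injective (∷-injectiveˡ (trans (sym eq) eq′)))

∈-compositions⁻ : ∀ n K {cs} → cs ∈ compositions n (suc K) →
  ∃₂ λ m ms → cs ≡ suc m ∷ ms × m < n × ms ∈ compositions (n ∸ suc m) K
∈-compositions⁻ n K cs∈ with ∈-concatMap⁻′ _ (upTo n) (subst (_ ∈_) (compositions-suc n K) cs∈)
... | m , m∈ , cs∈′ with ∈-map⁻ (suc m ∷_) cs∈′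
... | ms , ms∈ , eq = m , ms , eq , ∈-upTo⁻ m∈ , ms∈

∈-compositions⁺ : ∀ n K {m ms} → m < n → ms ∈ compositions (n ∸ suc m) K → suc m ∷ ms ∈ compositions n (suc K)
∈-compositions⁺ n K m< ms∈ = subst (_ ∈_) (sym (compositions-suc n K))
  (∈-concatMap⁺′ _ (∈-upTo⁺ m<) (∈-map⁺ _ ms∈))

∈-compositions-0 : ∀ n {cs} → cs ∈ compositions n 0 → n ≡ 0 × cs ≡ []
∈-compositions-0 zero (here eq) = refl , eq

∈-compositions₁⁻ : ∀ n {cs} → cs ∈ compositions n 1 → cs ≡ n ∷ [] × 0 < n
∈-compositions₁⁻ n cs∈ with ∈-compositions⁻ n 0 cs∈
... | m , ms , refl , m< , ms∈ with ∈-compositions-0 (n ∸ suc m) ms∈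
... | eq , refl = cong (_∷ []) (≤-antisym m< (m∸n≡0⇒m≤n eq)) , ≤-trans (s≤s z≤n) m<

∈-compositions₁⁺ : ∀ n → suc n ∷ [] ∈ compositions (suc n) 1
∈-compositions₁⁺ n = ∈-compositions⁺ (suc n) 0 (n<1+n n) (subst (λ k → [] ∈ compositions k 0) (sym (n∸n≡0 n)) (here refl))

allVecs-unique : ∀ k n → Unique (allVecs k n)
allVecs-unique zero    n = [] ∷ []
allVecs-unique (suc k) n = concatMap-unique _ (allVecs-unique k n)
  (λ v → Unique.map⁺ (λ { refl → refl }) (Unique.allFin⁺ n))
  λ y∈ y∈′ → let _ , _ , eq = ∈-map⁻ _ y∈ ; _ , _ , eq′ = ∈-map⁻ _ y∈′ in
    Vec.∷-injectiveʳ (trans (sym eq) eq′)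

∈-allVecs : ∀ {k n} (v : Vec (Fin n) k) → v ∈ allVecs k n
∈-allVecs []      = here refl
∈-allVecs (x ∷ v) = ∈-concatMap⁺′ _ (∈-allVecs v) (∈-map⁺ (_∷ v) (∈-allFin x))

-- The list filtered in the definition of `ε` has no repetitions, so its length is the cardinality
-- of any equivalent description of the planar data.
card-data : ∀ N K {S : Datum N → Set} →
  (∀ {cs v} → cs ∈ compositions (2 * N) K → IsFFInvolution v → GoodDatum 0 N K (cs , v) → S (cs , v)) →
  (∀ {cs v} → S (cs , v) → cs ∈ compositions (2 * N) K × IsFFInvolution v × GoodDatum 0 N K (cs , v)) →
  Card S (length (filter (goodDatum? 0 N K) (cartesianProduct (compositions (2 * N) K) (ffInvolutions (2 * N)))))
card-data N K to from = card-filter (goodDatum? 0 N K) _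
  (Unique.cartesianProduct⁺ (compositions-unique (2 * N) K)
    (Unique.filter⁺ isFFInvolution? (allVecs-unique (2 * N) (2 * N))))
  (λ d∈ good → let cs∈ , v∈ = ∈-cartesianProduct⁻ (compositions (2 * N) K) (ffInvolutions (2 * N)) d∈
               in to cs∈ (proj₂ (∈-filter⁻ isFFInvolution? {xs = allVecs (2 * N) (2 * N)} v∈)) good)
  (λ s → let cs∈ , ff , good = from s in
    ∈-cartesianProduct⁺ cs∈ (∈-filter⁺ isFFInvolution? (∈-allVecs _) ff) , good)

double : ∀ N → 2 * N ≡ N + N
double N = cong (N +_) (+-identityʳ N)

OneFace : ∀ N → Datum N → Set
OneFace N (cs , v) = cs ≡ 2 * N ∷ [] × NC v (allFin (2 * N)) × FixedOff v (allFin (2 * N))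

card-one-face : ∀ N {F} → 2 * N ≤ F → Card (OneFace N) (nc F (2 * N))
card-one-face N {F} 2N≤F = card-map (2 * N ∷ [] ,_) (λ { _ _ refl → refl })
  (refl ,_) (λ { (refl , s) → _ , s , refl })
  (subst (λ k → Card (λ v → NC v (allFin (2 * N)) × FixedOff v (allFin (2 * N))) (nc F k))
    (length-tabulate {n = 2 * N} (λ z → z))
    (card-NC F (allFin (2 * N)) (≤-trans (≤-reflexive (length-tabulate (λ z → z))) 2N≤F)
      (Unique.allFin⁺ (2 * N))))

one-face-≡ : ∀ {n m} → n ≡ suc m → IsCycle (tau (n ∷ [])) (allFin n)
one-face-≡ refl = one-face _

one-face-data : ∀ N {m} → 2 * N ≡ suc m →
  Card (OneFace N) (length (filter (goodDatum? 0 N 1) (cartesianProduct (compositions (2 * N) 1) (ffInvolutions (2 * N)))))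
one-face-data N {m} 2N≡ = card-data N 1 to from
  where
  cycle : IsCycle (tau (2 * N ∷ [])) (allFin (2 * N))
  cycle = one-face-≡ 2N≡
  -- Genus zero with one polygon means `N + 1` vertices, the maximum in `Extremal`.
  count : ∀ {c} → c + 1 + 0 ≡ N + 2 → c ≡ suc N
  count {c} e = +-cancelʳ-≡ 1 c (suc N) (trans (sym (+-identityʳ (c + 1))) (trans e (+-suc N 1)))
  count⁻¹ : ∀ {c} → c ≡ suc N → c + 1 + 0 ≡ N + 2
  count⁻¹ refl = trans (+-identityʳ (suc N + 1)) (sym (+-suc N 1))
  composition : 2 * N ∷ [] ∈ compositions (2 * N) 1
  composition = subst (λ n → n ∷ [] ∈ compositions n 1) (sym 2N≡) (∈-compositions₁⁺ m)
  to : ∀ {cs v} → cs ∈ compositions (2 * N) 1 → IsFFInvolution v → GoodDatum 0 N 1 (cs , v) → OneFace N (cs , v)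
  to {v = v} cs∈ ff (_ , e) with ∈-compositions₁⁻ (2 * N) cs∈
  ... | refl , _ = refl , one-face-planar⁻ cycle (double N) ff (count e) , λ z z∉ → ⊥-elim (z∉ (∈-allFin z))
  from : ∀ {cs v} → OneFace N (cs , v) → cs ∈ compositions (2 * N) 1 × IsFFInvolution v × GoodDatum 0 N 1 (cs , v)
  from {v = v} (refl , p , _) = composition , ff ,
    let t , e = one-face-planar⁺ cycle (double N) ff p in t , count⁻¹ e
    where
    ff : IsFFInvolution v
    ff z = NC-paired (Unique.allFin⁺ (2 * N)) p (∈-allFin z)

-- Every depth from `2 * N` on gives the same value, so a single `F` can serve all terms of the
-- recursion.
ε-one : ∀ N F → 2 * N ≤ F → ε 0 N 1 ≡ nc F (2 * N)
ε-one zero    F _   = refl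
ε-one (suc N) F 2N≤ = card-unique (one-face-data (suc N) refl) (card-one-face (suc N) 2N≤)

TwoFace : ∀ N → ℕ → Datum N → Set
TwoFace N a (cs , v) = let n = 2 * N ; ps = face₁ (suc a) n ; qs = face₂ (suc a) n in
  cs ≡ suc a ∷ n ∸ suc a ∷ [] × Ann v ps qs × FixedOff v (ps ++ qs)

face₁-length : ∀ {a n} → a ≤ n → length (face₁ a n) ≡ a
face₁-length {a} {n} a≤n = trans (length-take a (allFin n))
  (trans (cong (a ⊓_) (length-tabulate (λ z → z))) (m≤n⇒m⊓n≡m a≤n))

face₂-length : ∀ a n → length (face₂ a n) ≡ n ∸ a
face₂-length a n = trans (length-drop a (allFin n)) (cong (_∸ a) (length-tabulate (λ z → z)))

faces-unique : ∀ a n → Unique (face₁ a n ++ face₂ a n)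
faces-unique a n = subst Unique (sym (faces-++ a n)) (Unique.allFin⁺ n)

card-two-face : ∀ N {F} a b → 2 * N ≤ F → suc a + suc b ≡ 2 * N →
  Card (TwoFace N a) (ann F (suc a) (suc b))
card-two-face N {F} a b 2N≤F sizes = card-map (suc a ∷ 2 * N ∸ suc a ∷ [] ,_) (λ { _ _ refl → refl })
  (refl ,_) (λ { (refl , s) → _ , s , refl })
  (subst₂ (λ j k → Card (λ v → Ann v ps qs × FixedOff v (ps ++ qs)) (ann F j k)) ps-length qs-length
    (card-Ann F ps qs (≤-trans (≤-reflexive (trans (cong₂ _+_ ps-length qs-length) sizes)) 2N≤F)
      (faces-unique (suc a) (2 * N))))
  where
  ps = face₁ (suc a) (2 * N)
  qs = face₂ (suc a) (2 * N)
  ps-length : length ps ≡ suc a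
  ps-length = face₁-length (≤-trans (m≤m+n (suc a) (suc b)) (≤-reflexive sizes))
  qs-length : length qs ≡ suc b
  qs-length = trans (face₂-length (suc a) (2 * N))
    (trans (cong (_∸ suc a) (sym sizes)) (m+n∸m≡n (suc a) (suc b)))

∈-compositions₂⁻ : ∀ n {cs} → cs ∈ compositions n 2 →
  ∃₂ λ a b → cs ≡ suc a ∷ n ∸ suc a ∷ [] × suc a + suc b ≡ n
∈-compositions₂⁻ n cs∈ with ∈-compositions⁻ n 1 cs∈
... | a , ms , refl , a< , ms∈ with ∈-compositions₁⁻ (n ∸ suc a) ms∈
... | refl , 0< = a , n ∸ suc a ∸ 1 , refl ,
  trans (cong (suc a +_) (m+[n∸m]≡n 0<)) (m+[n∸m]≡n a<)

∈-compositions₂⁺ : ∀ {n} a b → suc a + suc b ≡ n → suc a ∷ n ∸ suc a ∷ [] ∈ compositions n 2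
∈-compositions₂⁺ a b refl = ∈-compositions⁺ (suc a + suc b) 1 (m≤m+n (suc a) (suc b))
  (subst (λ k → k ∷ [] ∈ compositions k 1) (sym (m+n∸m≡n (suc a) (suc b))) (∈-compositions₁⁺ b))

two-face-data : ∀ N {m} → 2 * N ≡ suc m →
  Card (λ d → ∃ λ a → a < m × TwoFace N a d)
    (length (filter (goodDatum? 0 N 2) (cartesianProduct (compositions (2 * N) 2) (ffInvolutions (2 * N)))))
two-face-data N {m} 2N≡ = card-data N 2 to from
  where
  S : Datum N → Set
  S d = ∃ λ a → a < m × TwoFace N a d
  cycles₂ : ∀ {a b} → suc a + suc b ≡ 2 * N →
    IsCycle (tau (suc a ∷ 2 * N ∸ suc a ∷ [])) (face₁ (suc a) (2 * N)) ×
    IsCycle (tau (suc a ∷ 2 * N ∸ suc a ∷ [])) (face₂ (suc a) (2 * N))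
  cycles₂ {a} {b} sizes = subst (λ k → let τ = tau (suc a ∷ k ∷ []) in
      IsCycle τ (face₁ (suc a) (2 * N)) × IsCycle τ (face₂ (suc a) (2 * N)))
    (trans (sym (m+n∸m≡n (suc a) (suc b))) (cong (_∸ suc a) sizes)) (two-faces-≡ sizes)
  -- Genus zero with two polygons means `N` vertices, the count in `Bridged` with no further
  -- polygons.
  count : ∀ {c} → c + 2 + 0 ≡ N + 2 → c ≡ N
  count {c} e = +-cancelʳ-≡ 2 c N (trans (sym (+-identityʳ (c + 2))) e)
  count⁻¹ : ∀ {c} → c ≡ N → c + 2 + 0 ≡ N + 2
  count⁻¹ refl = +-identityʳ (N + 2)
  to : ∀ {cs v} → cs ∈ compositions (2 * N) 2 → IsFFInvolution v → GoodDatum 0 N 2 (cs , v) → S (cs , v)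
  to {v = v} cs∈ ff (t , e) with ∈-compositions₂⁻ (2 * N) cs∈
  ... | a , b , refl , sizes = a , a<m , refl ,
    two-face-planar⁻ {a = suc a} (cycles₂ sizes) (double N) ff t (count e) ,
    λ z z∉ → ⊥-elim (z∉ (subst (z ∈_) (sym (faces-++ (suc a) (2 * N))) (∈-allFin z)))
    where
    a<m : a < m
    a<m = subst (suc a ≤_) (suc-injective (trans sizes 2N≡))
      (subst (suc a ≤_) (sym (+-suc a b)) (s≤s (m≤m+n a b)))
  from : ∀ {cs v} → S (cs , v) → cs ∈ compositions (2 * N) 2 × IsFFInvolution v × GoodDatum 0 N 2 (cs , v)
  from {v = v} (a , a<m , refl , p , _) = ∈-compositions₂⁺ a (m ∸ suc a) sizes , ff ,
    let t , e = two-face-planar⁺ {a = suc a} (cycles₂ sizes) (double N) ff p in t , count⁻¹ e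
    where
    sizes : suc a + suc (m ∸ suc a) ≡ 2 * N
    sizes = trans (+-suc (suc a) (m ∸ suc a)) (trans (cong suc (m+[n∸m]≡n a<m)) (sym 2N≡))
    ff : IsFFInvolution v
    ff z = Ann-paired (faces-unique (suc a) (2 * N)) p
      (subst (z ∈_) (sym (faces-++ (suc a) (2 * N))) (∈-allFin z))

-- The polygons have `suc a` and `suc b` letters, `2 * N` in all, so the sum runs over
-- `a + 1 + b = 2N - 1`.
ε-two : ∀ N F → 2 * N ≤ F → ε 0 N 2 ≡ conv (λ a b → ann F (suc a) (suc b)) (2 * N ∸ 1)
ε-two zero    F _   = refl
ε-two (suc N) F 2N≤ = card-unique (two-face-data (suc N) refl)
  (card-conv _ _ (λ { (refl , _) (refl , _) → refl })
    λ a b eq → card-two-face (suc N) a b 2N≤ (cong suc eq))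

-- Summation

conv-cong : ∀ {k l} p → (∀ a b → a + suc b ≡ p → k a b ≡ l a b) → conv k p ≡ conv l p
conv-cong zero    eq = refl
conv-cong (suc p) eq = cong₂ _+_ (eq 0 p refl) (conv-cong p (λ a b e → eq (suc a) b (cong suc e)))

conv-+ : ∀ k l p → conv (λ a b → k a b + l a b) p ≡ conv k p + conv l p
conv-+ k l zero    = refl
conv-+ k l (suc p) = trans (cong (k 0 p + l 0 p +_) (conv-+ (k ∘ suc) (l ∘ suc) p))
  (interchange (k 0 p) (l 0 p) (conv (k ∘ suc) p) (conv (l ∘ suc) p))
  where
  interchange : ∀ a b c d → a + b + (c + d) ≡ a + c + (b + d)
  interchange = solve-∀

conv-*ˡ : ∀ c k p → conv (λ a b → c * k a b) p ≡ c * conv k p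
conv-*ˡ c k zero    = sym (*-zeroʳ c)
conv-*ˡ c k (suc p) = trans (cong (c * k 0 p +_) (conv-*ˡ c (k ∘ suc) p)) (sym (*-distribˡ-+ c (k 0 p) _))

conv-*ʳ : ∀ c k p → conv (λ a b → k a b * c) p ≡ conv k p * c
conv-*ʳ c k p = trans (conv-cong p (λ a b _ → *-comm (k a b) c)) (trans (conv-*ˡ c k p) (*-comm c (conv k p)))

conv-const : ∀ c p → conv (λ _ _ → c) p ≡ p * c
conv-const c zero    = refl
conv-const c (suc p) = cong (c +_) (conv-const c p)

conv-last : ∀ k p → conv k (suc p) ≡ conv (λ a b → k a (suc b)) p + k p 0
conv-last k zero    = +-identityʳ (k 0 0)
conv-last k (suc p) = trans (cong (k 0 (suc p) +_) (conv-last (k ∘ suc) p)) (sym (+-assoc (k 0 (suc p)) _ _))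

conv-flip : ∀ k p → conv k p ≡ conv (flip k) p
conv-flip k zero    = refl
conv-flip k (suc p) = trans (cong (k 0 p +_) (conv-flip (k ∘ suc) p))
  (trans (+-comm (k 0 p) _) (sym (conv-last (flip k) p)))

-- Both sides run over all triples with `i + 1 + j + 1 + b = p`.
conv-assoc : ∀ (k : ℕ → ℕ → ℕ → ℕ) p →
  conv (λ a b → conv (λ i j → k i j b) a) p ≡ conv (λ i r → conv (λ j b → k i j b) r) p
conv-assoc k zero    = refl
conv-assoc k (suc p) = trans (conv-+ (k 0) (λ a b → conv (λ i j → k (suc i) j b) a) p)
  (cong (conv (k 0) p +_) (conv-assoc (k ∘ suc) p))

-- The sum of the numbers from 1 to `2N + 1`. It is the source of the coefficient in the theorem,
-- whose `N` is one larger than the one here.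
triangle : ∀ N → conv (λ _ b → suc b) (suc (2 * N)) ≡ suc N * suc (2 * N)
triangle zero    = refl
triangle (suc N) = begin
  conv k (suc (2 * suc N))                     ≡⟨ cong (conv k ∘ suc) (*-suc 2 N) ⟩
  3 + 2 * N + (2 + 2 * N + conv k (suc (2 * N))) ≡⟨ cong (λ t → 3 + 2 * N + (2 + 2 * N + t)) (triangle N) ⟩
  3 + 2 * N + (2 + 2 * N + suc N * suc (2 * N)) ≡⟨ arith N ⟩
  suc (suc N) * suc (2 * suc N)                ∎
  where
  open ≡-Reasoning
  k : ℕ → ℕ → ℕ
  k _ b = suc b
  arith : ∀ N → 3 + 2 * N + (2 + 2 * N + suc N * suc (2 * N)) ≡ suc (suc N) * suc (2 * suc N)
  arith = solve-∀

parity : ∀ n → ∃ λ i → n ≡ 2 * i ⊎ n ≡ suc (2 * i)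
parity zero = 0 , inj₁ refl
parity (suc n) with parity n
... | i , inj₁ e = i , inj₂ (cong suc e)
... | i , inj₂ e = suc i , inj₁ (trans (cong suc e) (sym (*-suc 2 i)))

conv-zero : ∀ {k} p → (∀ a b → a + suc b ≡ p → k a b ≡ 0) → conv k p ≡ 0
conv-zero p eq = trans (conv-cong p eq) (trans (conv-const 0 p) (*-zeroʳ p))

-- The two sides of the first arc have `2i - 1` letters together, so one of them is odd and its
-- factor vanishes by induction.
nc-odd : ∀ f i → nc f (suc (2 * i)) ≡ 0
nc-odd zero    i = refl
nc-odd (suc f) i = conv-zero (2 * i) vanish
  where
  sum-odd : ∀ c d → 2 * c + suc (2 * d) ≡ suc (2 * (c + d))
  sum-odd = solve-∀
  vanish : ∀ a b → a + suc b ≡ 2 * i → nc f a * nc f b ≡ 0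
  vanish a b e with parity a | parity b
  ... | c , inj₂ refl | _             = cong (_* nc f b) (nc-odd f c)
  ... | c , inj₁ refl | d , inj₂ refl = trans (cong (nc f a *_) (nc-odd f d)) (*-zeroʳ (nc f a))
  ... | c , inj₁ refl | d , inj₁ refl = ⊥-elim (even≢odd i (c + d) (trans (sym e) (sum-odd c d)))

sum-cong : ∀ {f g : ℕ → ℕ} n → (∀ i → i < n → f i ≡ g i) → sum (applyUpTo f n) ≡ sum (applyUpTo g n)
sum-cong zero    eq = refl
sum-cong (suc n) eq = cong₂ _+_ (eq 0 (s≤s z≤n)) (sum-cong n (λ i i< → eq (suc i) (s≤s i<)))

-- The indices add up to `2q` and odd first indices contribute nothing. The term with second index 0
-- vanishes too, which leaves `q` terms; this is why the sum in the theorem stops at `N - 2`.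
conv-even : ∀ k q → (∀ i b → k (suc (2 * i)) b ≡ 0) → (∀ a → k a 0 ≡ 0) →
  conv k (suc (2 * q)) ≡ sum (applyUpTo (λ i → k (2 * i) (2 * (q ∸ i))) q)
conv-even k zero    odd zero′ = cong (_+ 0) (zero′ 0)
conv-even k (suc q) odd zero′ = begin
  conv k (suc (2 * suc q))
    ≡⟨ cong (conv k ∘ suc) (*-suc 2 q) ⟩
  k 0 (2 + 2 * q) + (k 1 (suc (2 * q)) + conv k₂ (suc (2 * q)))
    ≡⟨ cong₂ _+_ (cong (k 0) (sym (*-suc 2 q))) (cong (_+ conv k₂ (suc (2 * q))) (odd 0 (suc (2 * q)))) ⟩
  k 0 (2 * suc q) + conv k₂ (suc (2 * q))
    ≡⟨ cong (k 0 (2 * suc q) +_) (conv-even k₂ q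
         (λ i b → trans (cong (λ j → k (suc j) b) (sym (*-suc 2 i))) (odd (suc i) b)) (λ a → zero′ (suc (suc a)))) ⟩
  k 0 (2 * suc q) + sum (applyUpTo (λ i → k (2 + 2 * i) (2 * (q ∸ i))) q)
    ≡⟨ cong (k 0 (2 * suc q) +_) (sum-cong q (λ i _ → cong (λ j → k j (2 * (q ∸ i))) (sym (*-suc 2 i)))) ⟩
  k 0 (2 * suc q) + sum (applyUpTo (λ i → k (2 * suc i) (2 * (q ∸ i))) q) ∎
  where
  open ≡-Reasoning
  k₂ : ℕ → ℕ → ℕ
  k₂ a = k (2 + a)

annuli : ℕ → ℕ → ℕ
annuli F n = conv (λ a b → ann F (suc a) (suc b)) (n ∸ 1)

-- On the left the first polygon may be empty; that term is `ann F 0 _ = 0`, and dropping it shifts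
-- the index.
annuli-suc : ∀ F r → conv (λ j b → ann F j (suc b)) r ≡ annuli F r
annuli-suc F zero    = refl
annuli-suc F (suc r) = refl

-- After the first arc has cut off a noncrossing part with `i` letters, the remaining lengths `j`
-- and `suc b` vary freely with fixed sum; regrouping by `i` collects them into `annuli`. The two
-- sides of the arc contribute equally. A crossing edge always leaves `M` letters on the merged
-- polygon, so its contribution is `nc F M` times the number of its possible ends.
ann-recurrence : ∀ F q → let M = 2 * q in
  conv (λ a b → ann (suc F) (suc a) (suc b)) (suc M) ≡
  2 * conv (λ i r → nc F i * annuli F r) (suc M) + suc q * suc M * nc F M
ann-recurrence F q = begin
  conv (λ a b → inside a b + across a b) (suc M)
    ≡⟨ conv-+ inside across (suc M) ⟩
  conv inside (suc M) + conv across (suc M)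
    ≡⟨ cong₂ _+_ inside-sum across-sum ⟩
  2 * T + suc q * suc M * nc F M ∎
  where
  open ≡-Reasoning
  M T : ℕ
  M = 2 * q
  T = conv (λ i r → nc F i * annuli F r) (suc M)
  left-term inside across : ℕ → ℕ → ℕ
  left-term a b = conv (λ i j → nc F i * ann F j (suc b)) a
  inside a b = conv (λ i j → nc F i * ann F j (suc b) + ann F i (suc b) * nc F j) a
  across a b = conv (λ c d → nc F (a + (d + c))) (suc b)

  inside-term : ∀ a b → inside a b ≡ left-term a b + left-term a b
  inside-term a b = trans (conv-+ (λ i j → nc F i * ann F j (suc b)) (λ i j → ann F i (suc b) * nc F j) a)
    (cong (left-term a b +_) (trans (conv-flip _ a) (conv-cong a (λ i j _ → *-comm (ann F j (suc b)) (nc F i)))))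

  left-sum : conv left-term (suc M) ≡ T
  left-sum = trans (conv-assoc (λ i j b → nc F i * ann F j (suc b)) (suc M))
    (conv-cong (suc M) (λ i r _ → trans (conv-*ˡ (nc F i) (λ j b → ann F j (suc b)) r)
      (cong (nc F i *_) (annuli-suc F r))))

  inside-sum : conv inside (suc M) ≡ 2 * T
  inside-sum = trans (conv-cong (suc M) (λ a b _ → inside-term a b))
    (trans (conv-+ left-term left-term (suc M))
      (cong₂ _+_ left-sum (trans left-sum (sym (+-identityʳ T)))))

  across-term : ∀ a b → a + suc b ≡ suc M → across a b ≡ suc b * nc F M
  across-term a b e = trans (conv-cong (suc b) (λ c d e′ → cong (nc F) (trans
      (cong (a +_) (suc-injective (trans (cong suc (+-comm d c)) (trans (sym (+-suc c d)) e′))))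
      (suc-injective (trans (sym (+-suc a b)) e)))))
    (conv-const (nc F M) (suc b))

  across-sum : conv across (suc M) ≡ suc q * suc M * nc F M
  across-sum = trans (conv-cong (suc M) across-term)
    (trans (conv-*ʳ (nc F M) (λ _ b → suc b) (suc M)) (cong (_* nc F M) (triangle q)))

theorem1 : ∀ (N : ℕ) → 2 ≤ N →
    ε 0 N 2 ≡ 2 * sum (map (λ i → ε₁ 0 i * ε 0 (N ∸ i ∸ 1) 2) (upTo (N ∸ 1)))
    + N * (2 * N ∸ 1) * ε₁ 0 (N ∸ 1)
theorem1 (suc q) _ = begin
  ε 0 (suc q) 2
    ≡⟨ ε-two (suc q) (suc F) (n≤1+n F) ⟩
  conv (λ a b → ann (suc F) (suc a) (suc b)) (2 * suc q ∸ 1)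
    ≡⟨ cong (conv _) 2N-1 ⟩
  conv (λ a b → ann (suc F) (suc a) (suc b)) (suc (2 * q))
    ≡⟨ ann-recurrence F q ⟩
  2 * conv (λ i r → nc F i * annuli F r) (suc (2 * q)) + suc q * suc (2 * q) * nc F (2 * q)
    ≡⟨ cong₂ (λ s t → 2 * s + t) sums
         (cong₂ (λ m e → suc q * m * e) (sym 2N-1) (sym (ε-one q F (*-monoʳ-≤ 2 (n≤1+n q))))) ⟩
  2 * sum (map term (upTo q)) + suc q * (2 * suc q ∸ 1) * ε₁ 0 q ∎
  where
  open ≡-Reasoning
  -- One unfolding of the recursion leads from depth `suc F` to `F`, and `F = 2N` is enough for all
  -- the smaller counts.
  F : ℕ
  F = 2 * suc q
  term : ℕ → ℕ
  term i = ε₁ 0 i * ε 0 (suc q ∸ i ∸ 1) 2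
  2N-1 : 2 * suc q ∸ 1 ≡ suc (2 * q)
  2N-1 = cong (_∸ 1) (*-suc 2 q)
  ≤F : ∀ {j} → j ≤ q → 2 * j ≤ F
  ≤F j≤q = *-monoʳ-≤ 2 (m≤n⇒m≤1+n j≤q)
  index : ∀ {i} → i ≤ q → suc q ∸ i ∸ 1 ≡ q ∸ i
  index {i} i≤q = cong (_∸ 1) (+-∸-assoc 1 i≤q)
  term-value : ∀ i → i < q → nc F (2 * i) * annuli F (2 * (q ∸ i)) ≡ term i
  term-value i i<q = sym (cong₂ _*_ (ε-one i F (≤F (<⇒≤ i<q)))
    (trans (cong (λ j → ε 0 j 2) (index (<⇒≤ i<q))) (ε-two (q ∸ i) F (≤F (m∸n≤m q i)))))
  sums : conv (λ i r → nc F i * annuli F r) (suc (2 * q)) ≡ sum (map term (upTo q))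
  sums = begin
    conv (λ i r → nc F i * annuli F r) (suc (2 * q))
      ≡⟨ conv-even (λ i r → nc F i * annuli F r) q
           (λ i r → cong (_* annuli F r) (nc-odd F i)) (λ i → *-zeroʳ (nc F i)) ⟩
    sum (applyUpTo (λ i → nc F (2 * i) * annuli F (2 * (q ∸ i))) q)
      ≡⟨ sum-cong q term-value ⟩
    sum (applyUpTo term q)
      ≡⟨ cong sum (sym (map-upTo term q)) ⟩
    sum (map term (upTo q)) ∎
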